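{- There is a constant $C$ such that for every sufficiently large $n$ there exists a $3$-planar graph of girth $5$ on $n$ vertices with at least $2.5n-C$ edges.
   Context: All graphs are finite and simple. A graph is $k$-planar if it admits a drawing in the plane in which every edge is crossed at most $k$ times. The girth of a graph is the length of its shortest cycle. (The paper states the edge count as $2.5n-O(1)$.) -}

module Defs where

open import Data.Bool using (Bool; false; T)
open import Data.Bool.Properties using (T?)
open import Data.Fin using (Fin; zero; suc; inject₁; fromℕ; _<_; _<?_)
open import Data.List using (length; filter; cartesianProduct; allFin)
open import Data.Nat as ℕ using (ℕ)
open import Data.Product using (Σ-syntax; ∃-syntax; _×_; _,_; proj₁; proj₂)
open import Data.Rational as ℚ using (ℚ; 0ℚ; 1ℚ; ∣_∣)
open import Function.Definitions using (Injective)
open import Relation.Binary.PropositionalEquality using (_≡_; _≢_)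
open import Relation.Nullary using (¬_)
open import Relation.Nullary.Decidable using (_×-dec_)

-- Real numbers are Cauchy sequences of rationals, taken up to _≈_.

record ℝ : Set where
  field
    seq    : ℕ → ℚ
    cauchy : ∀ ε → 0ℚ ℚ.< ε →
             ∃[ N ] (∀ m n → N ℕ.≤ m → N ℕ.≤ n → ∣ seq m ℚ.- seq n ∣ ℚ.≤ ε)

open ℝ public

-- |x − y| < ε implies Near ε x y, which implies |x − y| ≤ ε; so quantifying
-- over all ε > 0 gives the usual notions of equality and continuity.
Near : ℚ → ℝ → ℝ → Set
Near ε x y = ∃[ N ] (∀ n → N ℕ.≤ n → ∣ seq x n ℚ.- seq y n ∣ ℚ.≤ ε)

infix 4 _≈_ _≤ᵣ_ _≈₂_

_≈_ : ℝ → ℝ → Set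
x ≈ y = ∀ ε → 0ℚ ℚ.< ε → Near ε x y

_≤ᵣ_ : ℝ → ℝ → Set
x ≤ᵣ y = ∀ ε → 0ℚ ℚ.< ε →
         ∃[ N ] (∀ n → N ℕ.≤ n → seq x n ℚ.≤ seq y n ℚ.+ ε)

fromℚ : ℚ → ℝ
fromℚ q = record
  { seq    = λ _ → q
  ; cauchy = λ ε 0<ε → 0 , λ _ _ _ _ → q-q≤ ε 0<ε
  }
  where
  open import Data.Rational.Properties using (+-inverseʳ; <⇒≤)
  q-q≤ : ∀ ε → 0ℚ ℚ.< ε → ∣ q ℚ.- q ∣ ℚ.≤ ε
  q-q≤ ε 0<ε rewrite +-inverseʳ q = <⇒≤ 0<ε

0ℝ 1ℝ : ℝ
0ℝ = fromℚ 0ℚ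
1ℝ = fromℚ 1ℚ

Plane : Set
Plane = ℝ × ℝ

_≈₂_ : Plane → Plane → Set
(x , y) ≈₂ (x′ , y′) = (x ≈ x′) × (y ≈ y′)

Near₂ : ℚ → Plane → Plane → Set
Near₂ ε (x , y) (x′ , y′) = Near ε x x′ × Near ε y y′

record UnitInterval : Set where
  constructor mkI
  field
    value : ℝ
    lower : 0ℝ ≤ᵣ value
    upper : value ≤ᵣ 1ℝ

open UnitInterval public

0I 1I : UnitInterval
0I = mkI 0ℝ (λ ε 0<ε → 0 , λ _ _ → lem ε 0<ε) (λ ε 0<ε → 0 , λ _ _ → lem₁ ε 0<ε)
  where
  open import Data.Rational.Properties
  lem : ∀ ε → 0ℚ ℚ.< ε → 0ℚ ℚ.≤ 0ℚ ℚ.+ ε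
  lem ε 0<ε rewrite +-identityˡ ε = <⇒≤ 0<ε
  lem₁ : ∀ ε → 0ℚ ℚ.< ε → 0ℚ ℚ.≤ 1ℚ ℚ.+ ε
  lem₁ ε 0<ε = +-mono-≤ (nonNegative⁻¹ 1ℚ) (<⇒≤ 0<ε)
1I = mkI 1ℝ (λ ε 0<ε → 0 , λ _ _ → lem ε 0<ε) (λ ε 0<ε → 0 , λ _ _ → lem₁ ε 0<ε)
  where
  open import Data.Rational.Properties
  lem : ∀ ε → 0ℚ ℚ.< ε → 0ℚ ℚ.≤ 1ℚ ℚ.+ ε
  lem ε 0<ε = +-mono-≤ (nonNegative⁻¹ 1ℚ) (<⇒≤ 0<ε)
  lem₁ : ∀ ε → 0ℚ ℚ.< ε → 1ℚ ℚ.≤ 1ℚ ℚ.+ ε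
  lem₁ ε 0<ε = +-monoʳ-≤ 1ℚ (<⇒≤ 0<ε)

Interior : UnitInterval → Set
Interior t = ¬ (value t ≈ 0ℝ) × ¬ (value t ≈ 1ℝ)

Continuous : (UnitInterval → Plane) → Set
Continuous γ = ∀ t ε → 0ℚ ℚ.< ε →
  Σ[ δ ∈ ℚ ] 0ℚ ℚ.< δ × (∀ s → Near δ (value s) (value t) → Near₂ ε (γ s) (γ t))

-- Continuity already forces γ to respect _≈_.
record SimpleArc (p q : Plane) : Set where
  field
    γ          : UnitInterval → Plane
    continuous : Continuous γ
    injective  : ∀ s t → γ s ≈₂ γ t → value s ≈ value t
    start      : γ 0I ≈₂ p
    end        : γ 1I ≈₂ q

record Graph (n : ℕ) : Set where
  field
    adj    : Fin n → Fin n → Bool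
    sym    : ∀ u v → adj u v ≡ adj v u
    irrefl : ∀ u → adj u u ≡ false

  _~_ : Fin n → Fin n → Set
  u ~ v = T (adj u v)

-- An undirected edge is represented by its endpoints in increasing order.
record Edge {n : ℕ} (G : Graph n) : Set where
  constructor mkEdge
  open Graph G
  field
    lo hi    : Fin n
    lo<hi    : lo < hi
    adjacent : lo ~ hi

numEdges : ∀ {n} → Graph n → ℕ
numEdges {n} G =
  length (filter (λ e → (proj₁ e <? proj₂ e) ×-dec T? (adj (proj₁ e) (proj₂ e)))
                 (cartesianProduct (allFin n) (allFin n)))
  where open Graph G

-- A cycle of length m + 1 visits vertex 0, …, vertex m and returns to vertex 0.
record Cycle {n : ℕ} (G : Graph n) (m : ℕ) : Set where
  open Graph G
  field
    length≥3 : 3 ℕ.≤ ℕ.suc m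
    vertex   : Fin (ℕ.suc m) → Fin n
    distinct : Injective _≡_ _≡_ vertex
    step     : ∀ (i : Fin m) → vertex (inject₁ i) ~ vertex (suc i)
    close    : vertex (fromℕ m) ~ vertex zero

HasCycleOfLength : ∀ {n} → Graph n → ℕ → Set
HasCycleOfLength G ℓ = Σ[ m ∈ ℕ ] ℓ ≡ ℕ.suc m × Cycle G m

HasGirth : ∀ {n} → Graph n → ℕ → Set
HasGirth G g = HasCycleOfLength G g × (∀ ℓ → HasCycleOfLength G ℓ → g ℕ.≤ ℓ)

record Drawing {n : ℕ} (G : Graph n) : Set where
  open Edge
  open SimpleArc
  field
    pos           : Fin n → Plane
    pos-injective : ∀ u v → pos u ≈₂ pos v → u ≡ v
    arc           : (e : Edge G) → SimpleArc (pos (lo e)) (pos (hi e))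
    avoids        : ∀ e t → Interior t → ∀ w → ¬ (γ (arc e) t ≈₂ pos w)

  curve : Edge G → UnitInterval → Plane
  curve e = γ (arc e)

-- Any common interior point of two edges counts as a crossing (including a
-- touching), and a point shared with several other edges counts once for each.
record Crossing {n : ℕ} {G : Graph n} (D : Drawing G) (e : Edge G) : Set where
  open Drawing D
  field
    other : Edge G
    other≢e : other ≢ e
    at : UnitInterval
    at-int : Interior at
    otherAt : UnitInterval
    otherAt-int : Interior otherAt
    meet : curve e at ≈₂ curve other otherAt

SameCrossing : ∀ {n} {G : Graph n} {D : Drawing G} {e : Edge G} →
               Crossing D e → Crossing D e → Set
SameCrossing {D = D} {e = e} c c′ =
  other c ≡ other c′ × Drawing.curve D e (at c) ≈₂ Drawing.curve D e (at c′)
  where open Crossing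

CrossedAtMost : ∀ {n} {G : Graph n} → ℕ → Drawing G → Edge G → Set
CrossedAtMost k D e =
  ¬ (Σ[ c ∈ (Fin (ℕ.suc k) → Crossing D e) ]
       (∀ i j → i ≢ j → ¬ SameCrossing (c i) (c j)))

KPlanar : ∀ {n} → ℕ → Graph n → Set
KPlanar k G = Σ[ D ∈ Drawing G ] (∀ e → CrossedAtMost k D e)

{-# OPTIONS --safe #-}

-- The plane is filled by layers of six vertices, layer q being 3^q times a fixed hexagon, and
-- fifteen types of straight edges are repeated in every layer.  The picture is invariant under
-- scaling by 3, so its first n vertices miss only boundedly many of the 15 edges per 6 vertices,
-- and every property needed of the drawing is a property of finitely many pairs of segments:
-- two edges whose layers differ by at least 3 are separated by a line that has the origin on the
-- inner side, and the remaining pairs are checked one by one.  A pair that is not separated by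
-- one of a few candidate lines counts as a potential crossing; each edge has at most three of
-- these, and they are transversal, so each contributes a single point.  In the quotient by the
-- scaling, closed walks are walks returning to their class with total layer change 0, which
-- makes the absence of 3- and 4-cycles a finite check as well.
module Submission where

open import Data.Bool.Properties using (T?; T-irrelevant; ∨-comm)
open import Data.Fin as Fin using (Fin; suc; toℕ; fromℕ<; inject₁; inject≤; remQuot; combine; #_)
import Data.Fin.Properties as Finₚ
open import Data.Integer as ℤ using (ℤ; +_; -[1+_]; 0ℤ; 1ℤ)
import Data.Integer.Properties as ℤₚ
open import Data.Integer.Solver renaming (module +-*-Solver to ℤ-Solver)
open import Data.List as List using (List; []; _∷_; _++_; length; filter; allFin; cartesianProduct)
open import Data.List.Membership.Propositional using (_∈_)
open import Data.List.Membership.Propositional.Properties using (∈-filter⁺; ∈-cartesianProduct⁺; ∈-allFin; ∈-map⁺; ∈-++⁺ˡ; ∈-++⁺ʳ)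
open import Data.List.Relation.Unary.All as All using (All)
open import Data.List.Relation.Unary.Any as Any using (Any)
open import Data.List.Relation.Unary.Any.Properties using (lookup-index)
open import Data.Nat as ℕ using (ℕ; _+_; _*_; _≤_; _^_; zero; suc; s≤s; z≤n)
open import Data.Nat.Coprimality using (1-coprimeTo) renaming (sym to coprime-sym)
open import Data.Nat.Divisibility using (n∣m*n)
open import Data.Nat.DivMod as DivMod using (_/_; _%_; _mod_)
import Data.Nat.Properties as ℕₚ
open import Data.Nat.Solver renaming (module +-*-Solver to ℕ-Solver)
open import Data.Product using (Σ-syntax; ∃-syntax; _×_; _,_; proj₁; proj₂)
open import Data.Product.Properties using (≡-dec)
open import Data.Rational as ℚ using (ℚ; 0ℚ; 1ℚ; ½; ∣_∣; mkℚ)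
import Data.Rational.Properties as ℚₚ
open import Data.Rational.Solver renaming (module +-*-Solver to ℚ-Solver)
open import Data.Sum using (_⊎_; inj₁; inj₂; [_,_]′)
open import Data.Vec as Vec using (Vec; []; _∷_; lookup)
open import Function using (_∘_)
open import Relation.Binary.PropositionalEquality using (_≡_; _≢_; refl; sym; trans; cong; cong₂; subst; subst₂)
open import Relation.Nullary using (¬_; Dec; yes; no; contradiction)
open import Relation.Nullary.Decidable using (_×-dec_; _⊎-dec_; _→-dec_; ¬?; ⌊_⌋; map′; from-yes; from-no; toWitness; fromWitness; isYes≗does; dec-false)
open import Defs

-- Integer points, segments and separating lines

Point : Set
Point = ℤ × ℤ

Segment : Set
Segment = Point × Point

infixl 7 _·_ _∙_ _•_

_∙_ : Point → Point → ℤ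
(a , b) ∙ (x , y) = a ℤ.* x ℤ.+ b ℤ.* y

_·_ : ℕ → Point → Point
k · (x , y) = + k ℤ.* x , + k ℤ.* y

_•_ : ℕ → Segment → Segment
k • (p , q) = k · p , k · q

perp : Point → Point
perp (x , y) = ℤ.- y , x

opposite : Point → Point
opposite (x , y) = ℤ.- x , ℤ.- y

_⊞_ : Point → Point → Point
(x , y) ⊞ (x′ , y′) = x ℤ.+ x′ , y ℤ.+ y′

direction : Segment → Point
direction (p , q) = q ⊞ opposite p

-- The line f = c weakly separates σ from τ and does not contain both of them; then the open
-- segments are disjoint.
record SeparatedBy (f : Point) (c : ℤ) (σ τ : Segment) : Set where
  constructor separatedBy
  field
    below₁ : f ∙ proj₁ σ ℤ.≤ c
    below₂ : f ∙ proj₂ σ ℤ.≤ c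
    above₁ : c ℤ.≤ f ∙ proj₁ τ
    above₂ : c ℤ.≤ f ∙ proj₂ τ
    strict : (f ∙ proj₁ σ ℤ.< c ⊎ f ∙ proj₂ σ ℤ.< c) ⊎ (c ℤ.< f ∙ proj₁ τ ⊎ c ℤ.< f ∙ proj₂ τ)

separatedBy? : ∀ f c σ τ → Dec (SeparatedBy f c σ τ)
separatedBy? f c σ τ =
  map′ (λ (b₁ , b₂ , a₁ , a₂ , s) → separatedBy b₁ b₂ a₁ a₂ s)
       (λ (separatedBy b₁ b₂ a₁ a₂ s) → b₁ , b₂ , a₁ , a₂ , s)
       ((f ∙ proj₁ σ ℤ.≤? c) ×-dec (f ∙ proj₂ σ ℤ.≤? c)
        ×-dec (c ℤ.≤? f ∙ proj₁ τ) ×-dec (c ℤ.≤? f ∙ proj₂ τ)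
        ×-dec ((f ∙ proj₁ σ ℤ.<? c ⊎-dec f ∙ proj₂ σ ℤ.<? c)
               ⊎-dec (c ℤ.<? f ∙ proj₁ τ ⊎-dec c ℤ.<? f ∙ proj₂ τ)))

-- By the separating axis theorem the two normals suffice for disjoint non-collinear segments; the
-- next two functionals serve degenerate or collinear ones, the last three the pairs with τ far out.
candidates : Segment → Segment → List Point
candidates σ τ = List.concatMap (λ f → f ∷ opposite f ∷ [])
  (perp (direction σ) ∷ perp (direction τ) ∷ direction σ
   ∷ proj₁ τ ⊞ opposite (proj₁ σ) ∷ proj₁ τ ⊞ proj₂ τ ∷ proj₁ τ ∷ proj₂ τ ∷ [])

-- For a given `f` the least level that leaves σ below is the only one worth testing: if a higher
-- level separates, so does this one.
Separable : Segment → Segment → Set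
Separable σ τ =
  Any (λ f → SeparatedBy f (f ∙ proj₁ σ ℤ.⊔ f ∙ proj₂ σ) σ τ) (candidates σ τ)

separable? : ∀ σ τ → Dec (Separable σ τ)
separable? σ τ = Any.any? (λ f → separatedBy? f _ σ τ) (candidates σ τ)

-- With c ≥ 0 the separation survives any enlargement of τ.
Separable⁺ : Segment → Segment → Set
Separable⁺ σ τ =
  Any (λ f → SeparatedBy f (0ℤ ℤ.⊔ (f ∙ proj₁ σ ℤ.⊔ f ∙ proj₂ σ)) σ τ) (candidates σ τ)

separable⁺? : ∀ σ τ → Dec (Separable⁺ σ τ)
separable⁺? σ τ = Any.any? (λ f → separatedBy? f _ σ τ) (candidates σ τ)

-- The pattern of one layer

site : Fin 6 → Point
site = lookup ( (+ 2 , ℤ.- + 2) ∷ (+ 0 , ℤ.- + 1) ∷ (ℤ.- + 2 , ℤ.- + 1)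
              ∷ (ℤ.- + 2 , + 1) ∷ (+ 0 , + 2) ∷ (+ 2 , + 1) ∷ [])

-- (r , r′ , d) stands for the edges from site r of layer q to site r′ of layer q + d, for all q.
-- The sites and bonds were found by a computer search.
bonds : Vec (Fin 6 × Fin 6 × ℕ) 15
bonds = (# 0 , # 1 , 2) ∷ (# 0 , # 5 , 0) ∷ (# 0 , # 5 , 2) ∷ (# 1 , # 0 , 2) ∷ (# 1 , # 1 , 1)
      ∷ (# 1 , # 2 , 2) ∷ (# 2 , # 1 , 1) ∷ (# 2 , # 4 , 1) ∷ (# 3 , # 2 , 1) ∷ (# 3 , # 2 , 2)
      ∷ (# 4 , # 3 , 1) ∷ (# 4 , # 4 , 1) ∷ (# 4 , # 5 , 2) ∷ (# 5 , # 0 , 1) ∷ (# 5 , # 4 , 2) ∷ []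

Bond : Set
Bond = Fin 15

src tgt : Bond → Fin 6
src e = proj₁ (lookup bonds e)
tgt e = proj₁ (proj₂ (lookup bonds e))

rise : Bond → ℕ
rise e = proj₂ (proj₂ (lookup bonds e))

Shape : Set
Shape = Bond ⊎ Fin 6

-- A site is encoded as a degenerate segment, so that coincident vertices, vertices on edges and
-- crossings of edges all fall under one separation test.
shape : Shape → Segment
shape (inj₁ e) = site (src e) , 3 ^ rise e · site (tgt e)
shape (inj₂ r) = site r , site r

all-shapes? : ∀ {P : Shape → Set} → (∀ s → Dec (P s)) → Dec (∀ s → P s)
all-shapes? P? = map′ (λ { (f , g) (inj₁ e) → f e ; (f , g) (inj₂ r) → g r })
                      (λ h → (h ∘ inj₁) , (h ∘ inj₂))
                      (Finₚ.all? (P? ∘ inj₁) ×-dec Finₚ.all? (P? ∘ inj₂))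

-- Finite checks for the drawing

-- The finite checks are abstract so that their (huge) normal forms are never compared later.
abstract
  -- The factor 27 = 3^3 is a gap of exactly three layers. Larger gaps only enlarge the second
  -- segment further, which `Separable⁺` tolerates.
  far-shapes-separable : ∀ s s′ → Separable⁺ (shape s) (27 • shape s′)
  far-shapes-separable =
    from-yes (all-shapes? λ s → all-shapes? λ s′ → separable⁺? (shape s) (27 • shape s′))

-- The offset o encodes that s′ lies o − 2 layers above s; everything is enlarged by 3² to stay in ℤ.
record Cleared (s s′ : Shape) (o : Fin 5) : Set where
  constructor cleared
  field separation : Separable (9 • shape s) (3 ^ toℕ o • shape s′)

cleared? : ∀ s s′ o → Dec (Cleared s s′ o)
cleared? s s′ o = map′ cleared Cleared.separation (separable? (9 • shape s) (3 ^ toℕ o • shape s′))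

abstract
  -- Offset 2 stands for equal layers, so the one exception is a vertex compared with itself.
  near-sites : ∀ r r′ o → (r ≡ r′ × o ≡ # 2) ⊎ Cleared (inj₂ r) (inj₂ r′) o
  near-sites = from-yes (Finₚ.all? λ r → Finₚ.all? λ r′ → Finₚ.all? λ o →
    (r Fin.≟ r′ ×-dec o Fin.≟ # 2) ⊎-dec cleared? (inj₂ r) (inj₂ r′) o)

  -- The endpoints of the bond itself need no exception: a functional that is extremal on the bond
  -- only at that endpoint separates weakly, with strictness at the other end.
  near-bond-site : ∀ e r o → Cleared (inj₁ e) (inj₂ r) o
  near-bond-site = from-yes (Finₚ.all? λ e → Finₚ.all? λ r → Finₚ.all? λ o →
    cleared? (inj₁ e) (inj₂ r) o)

Crosses : Bond → Bond × Fin 5 → Set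
Crosses e (e′ , o) = ¬ (e ≡ e′ × o ≡ # 2) × ¬ Cleared (inj₁ e) (inj₁ e′) o

crosses? : ∀ e x → Dec (Crosses e x)
crosses? e (e′ , o) = ¬? (e Fin.≟ e′ ×-dec o Fin.≟ # 2) ×-dec ¬? (cleared? (inj₁ e) (inj₁ e′) o)

-- The expression is the cross product of the two directions, so the segments are not parallel.
Transversal : Segment → Segment → Set
Transversal σ τ = perp (direction σ) ∙ direction τ ≢ 0ℤ

transversal? : ∀ σ τ → Dec (Transversal σ τ)
transversal? σ τ = ¬? (perp (direction σ) ∙ direction τ ℤ.≟ 0ℤ)

abstract
  crossings : Bond → List (Bond × Fin 5)
  crossings e = filter (crosses? e) (cartesianProduct (allFin 15) (allFin 5))

  crosses⇒∈-crossings : ∀ e x → Crosses e x → x ∈ crossings e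
  crosses⇒∈-crossings e (e′ , o) = ∈-filter⁺ (crosses? e) (∈-cartesianProduct⁺ (∈-allFin e′) (∈-allFin o))

  at-most-three : ∀ e → length (crossings e) ℕ.≤ 3
  at-most-three = from-yes (Finₚ.all? λ e → length (crossings e) ℕ.≤? 3)

  crossings-transversal : ∀ e → All (λ x → Transversal (shape (inj₁ e)) (shape (inj₁ (proj₁ x)))) (crossings e)
  crossings-transversal = from-yes (Finₚ.all? λ e →
    All.all? (λ x → transversal? (shape (inj₁ e)) (shape (inj₁ (proj₁ x)))) (crossings e))

-- The site reached and the change of layer when following an edge in either direction.
Move : Set
Move = Fin 6 × ℤ

abstract
  moves : Fin 6 → List Move
  moves r = List.map (λ e → tgt e , + rise e) (filter (λ e → src e Fin.≟ r) (allFin 15))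
         ++ List.map (λ e → src e , ℤ.- + rise e) (filter (λ e → tgt e Fin.≟ r) (allFin 15))

  ascent∈moves : ∀ e → (tgt e , + rise e) ∈ moves (src e)
  ascent∈moves e = ∈-++⁺ˡ (∈-map⁺ _ (∈-filter⁺ (λ e′ → src e′ Fin.≟ src e) (∈-allFin e) refl))

  descent∈moves : ∀ e → (src e , ℤ.- + rise e) ∈ moves (tgt e)
  descent∈moves e = ∈-++⁺ʳ _ (∈-map⁺ _ (∈-filter⁺ (λ e′ → tgt e′ Fin.≟ tgt e) (∈-allFin e) refl))

  -- A triangle projects to three moves that return to their class with layer changes adding up to
  -- 0.
  no-triangle : ∀ r → All (λ (r₁ , d₁) → All (λ (r₂ , d₂) → All (λ (r₃ , d₃) →
    ¬ (r₃ ≡ r × d₁ ℤ.+ d₂ ℤ.+ d₃ ≡ 0ℤ)) (moves r₂)) (moves r₁)) (moves r)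
  no-triangle = from-yes (Finₚ.all? λ r → All.all? (λ (r₁ , d₁) → All.all? (λ (r₂ , d₂) →
    All.all? (λ (r₃ , d₃) → ¬? (r₃ Fin.≟ r ×-dec d₁ ℤ.+ d₂ ℤ.+ d₃ ℤ.≟ 0ℤ))
    (moves r₂)) (moves r₁)) (moves r))

  -- Closed walks of four steps do exist, by backtracking. The conclusion says that only these
  -- exist: the first and third vertices coincide, or the second and fourth.
  no-quadrilateral : ∀ r → All (λ (r₁ , d₁) → All (λ (r₂ , d₂) → All (λ (r₃ , d₃) → All (λ (r₄ , d₄) →
    r₄ ≡ r × d₁ ℤ.+ d₂ ℤ.+ d₃ ℤ.+ d₄ ≡ 0ℤ →
    (r₂ ≡ r × d₁ ℤ.+ d₂ ≡ 0ℤ) ⊎ (r₃ ≡ r₁ × d₂ ℤ.+ d₃ ≡ 0ℤ)) (moves r₃)) (moves r₂)) (moves r₁)) (moves r)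
  no-quadrilateral = from-yes (Finₚ.all? λ r → All.all? (λ (r₁ , d₁) → All.all? (λ (r₂ , d₂) →
    All.all? (λ (r₃ , d₃) → All.all? (λ (r₄ , d₄) →
    (r₄ Fin.≟ r ×-dec d₁ ℤ.+ d₂ ℤ.+ d₃ ℤ.+ d₄ ℤ.≟ 0ℤ) →-dec
    ((r₂ Fin.≟ r ×-dec d₁ ℤ.+ d₂ ℤ.≟ 0ℤ) ⊎-dec (r₃ Fin.≟ r₁ ×-dec d₂ ℤ.+ d₃ ℤ.≟ 0ℤ)))
    (moves r₃)) (moves r₂)) (moves r₁)) (moves r))

abstract
  -- Site r of layer q will be vertex r + 6q, so every bond points from the smaller vertex number to
  -- the larger one.
  bond-increasing : ∀ e → toℕ (src e) ℕ.< toℕ (tgt e) ℕ.+ rise e ℕ.* 6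
  bond-increasing = from-yes (Finₚ.all? λ e → toℕ (src e) ℕ.<? toℕ (tgt e) ℕ.+ rise e ℕ.* 6)

  bond-rise≤2 : ∀ e → rise e ℕ.≤ 2
  bond-rise≤2 = from-yes (Finₚ.all? λ e → rise e ℕ.≤? 2)

  bond-unique : ∀ e e′ → lookup bonds e ≡ lookup bonds e′ → e ≡ e′
  bond-unique = from-yes (Finₚ.all? λ e → Finₚ.all? λ e′ →
    ≡-dec Fin._≟_ (≡-dec Fin._≟_ ℕ._≟_) (lookup bonds e) (lookup bonds e′) →-dec e Fin.≟ e′)

-- Limits of rational sequences

abstract
  -- Built with denominator 1 instead of by normalising division, so that numerators and comparisons
  -- compute; `ι≡/1` links the two forms.
  ι : ℤ → ℚ
  ι z = mkℚ z 0 (coprime-sym (1-coprimeTo ℤ.∣ z ∣))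

  ι≡/1 : ∀ z → z ℚ./ 1 ≡ ι z
  ι≡/1 z = ℚₚ.↥p/↧p≡p (ι z)

  ι-+ : ∀ x y → ι (x ℤ.+ y) ≡ ι x ℚ.+ ι y
  ι-+ x y = trans (sym (ι≡/1 _))
    (cong (ℚ._/ 1) (sym (cong₂ ℤ._+_ (ℤₚ.*-identityʳ x) (ℤₚ.*-identityʳ y))))

  ι-* : ∀ x y → ι (x ℤ.* y) ≡ ι x ℚ.* ι y
  ι-* x y = sym (ι≡/1 _)

  ι-neg : ∀ x → ι (ℤ.- x) ≡ ℚ.- ι x
  ι-neg (+ zero)  = refl
  ι-neg (+ suc n) = refl
  ι-neg -[1+ n ]  = refl

  ι-mono-≤ : ∀ {x y} → x ℤ.≤ y → ι x ℚ.≤ ι y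
  ι-mono-≤ {x} {y} x≤y = ℚ.*≤* (subst₂ ℤ._≤_ (sym (ℤₚ.*-identityʳ x)) (sym (ℤₚ.*-identityʳ y)) x≤y)

  ι-mono-< : ∀ {x y} → x ℤ.< y → ι x ℚ.< ι y
  ι-mono-< {x} {y} x<y = ℚ.*<* (subst₂ ℤ._<_ (sym (ℤₚ.*-identityʳ x)) (sym (ℤₚ.*-identityʳ y)) x<y)

  ι≢0 : ∀ {z} → z ≢ 0ℤ → ι z ≢ 0ℚ
  ι≢0 z≢0 eq = z≢0 (cong ℚ.numerator eq)

Seq : Set
Seq = ℕ → ℚ

Eventually : (ℕ → Set) → Set
Eventually P = ∃[ N ] (∀ n → N ℕ.≤ n → P n)

-- lim inf f ≥ 0
record NonNegative∞ (f : Seq) : Set where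
  constructor nn
  field nn⁻¹ : ∀ ε → 0ℚ ℚ.< ε → Eventually (λ n → 0ℚ ℚ.≤ f n ℚ.+ ε)

-- For the difference of the sequences of x and y the field is exactly `x ≈ y`. The record wrapper
-- lets `f` be inferred.
record Null (f : Seq) : Set where
  constructor null
  field null⁻¹ : ∀ ε → 0ℚ ℚ.< ε → Eventually (λ n → ∣ f n ∣ ℚ.≤ ε)

open Null

eventually-map : ∀ {P Q : ℕ → Set} → (∀ n → P n → Q n) → Eventually P → Eventually Q
eventually-map h (N , p) = N , λ n N≤n → h n (p n N≤n)

eventually-zip : ∀ {P Q R : ℕ → Set} → (∀ n → P n → Q n → R n) →
                 Eventually P → Eventually Q → Eventually R
eventually-zip h (M , p) (N , q) = M ℕ.⊔ N , λ n M⊔N≤n →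
  h n (p n (ℕₚ.m⊔n≤o⇒m≤o M N M⊔N≤n)) (q n (ℕₚ.m⊔n≤o⇒n≤o M N M⊔N≤n))

0<p*q : ∀ {p q} → 0ℚ ℚ.< p → 0ℚ ℚ.< q → 0ℚ ℚ.< p ℚ.* q
0<p*q {p} {q} 0<p 0<q =
  ℚₚ.positive⁻¹ (p ℚ.* q) {{ℚₚ.pos*pos⇒pos p {{ℚ.positive 0<p}} q {{ℚ.positive 0<q}}}}

0<½ : 0ℚ ℚ.< ½
0<½ = ℚₚ.positive⁻¹ ½

½+½ : ∀ ε → ½ ℚ.* ε ℚ.+ ½ ℚ.* ε ≡ ε
½+½ ε = trans (sym (ℚₚ.*-distribʳ-+ ε ½ ½)) (ℚₚ.*-identityˡ ε)

*-monoʳ-≤ : ∀ {p q r} → 0ℚ ℚ.≤ r → p ℚ.≤ q → r ℚ.* p ℚ.≤ r ℚ.* q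
*-monoʳ-≤ {r = r} 0≤r p≤q = ℚₚ.*-monoˡ-≤-nonNeg r {{ℚ.nonNegative 0≤r}} p≤q

shrink : ∀ q ε → 0ℚ ℚ.< ε → ∃[ δ ] (0ℚ ℚ.< δ × ∣ q ∣ ℚ.* δ ℚ.≤ ε)
shrink q ε 0<ε = 1/k ℚ.* ε , 0<δ , bound
  where
  open ℚₚ.≤-Reasoning
  k : ℚ
  -- Adding 1 keeps the divisor positive even for q = 0.
  k = ∣ q ∣ ℚ.+ 1ℚ
  0<k : 0ℚ ℚ.< k
  0<k = ℚₚ.+-mono-≤-< (ℚₚ.0≤∣p∣ q) (ℚₚ.positive⁻¹ 1ℚ)
  instance
    k⁺ : ℚ.Positive k
    k⁺ = ℚ.positive 0<k
    k≢0 : ℚ.NonZero k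
    k≢0 = ℚₚ.pos⇒nonZero k
  1/k : ℚ
  1/k = ℚ.1/ k
  0<δ : 0ℚ ℚ.< 1/k ℚ.* ε
  0<δ = 0<p*q (ℚₚ.positive⁻¹ 1/k {{ℚₚ.1/pos⇒pos k}}) 0<ε
  ∣q∣≤k : ∣ q ∣ ℚ.≤ k
  ∣q∣≤k = subst (ℚ._≤ k) (ℚₚ.+-identityʳ ∣ q ∣) (ℚₚ.+-monoʳ-≤ ∣ q ∣ (ℚₚ.nonNegative⁻¹ 1ℚ))
  bound : ∣ q ∣ ℚ.* (1/k ℚ.* ε) ℚ.≤ ε
  bound = begin
    ∣ q ∣ ℚ.* (1/k ℚ.* ε)  ≤⟨ ℚₚ.*-monoʳ-≤-nonNeg (1/k ℚ.* ε) {{ℚ.nonNegative (ℚₚ.<⇒≤ 0<δ)}} ∣q∣≤k ⟩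
    k ℚ.* (1/k ℚ.* ε)      ≡⟨ ℚₚ.*-assoc k 1/k ε ⟨
    k ℚ.* 1/k ℚ.* ε        ≡⟨ cong (ℚ._* ε) (ℚₚ.*-inverseʳ k) ⟩
    1ℚ ℚ.* ε               ≡⟨ ℚₚ.*-identityˡ ε ⟩
    ε                      ∎

nn-cong : ∀ {f g} → (∀ n → f n ≡ g n) → NonNegative∞ f → NonNegative∞ g
nn-cong f≗g (nn p) = nn λ ε 0<ε → eventually-map (λ n → subst (λ x → 0ℚ ℚ.≤ x ℚ.+ ε) (f≗g n)) (p ε 0<ε)

null-cong : ∀ {f g} → (∀ n → f n ≡ g n) → Null f → Null g
null-cong f≗g (null p) = null λ ε 0<ε → eventually-map (λ n → subst (λ x → ∣ x ∣ ℚ.≤ ε) (f≗g n)) (p ε 0<ε)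

nn-+ : ∀ {f g} → NonNegative∞ f → NonNegative∞ g → NonNegative∞ (λ n → f n ℚ.+ g n)
nn-+ {f} {g} (nn p) (nn q) = nn λ ε 0<ε →
  eventually-zip (step ε) (p (½ ℚ.* ε) (0<p*q 0<½ 0<ε)) (q (½ ℚ.* ε) (0<p*q 0<½ 0<ε))
  where
  step : ∀ ε n → 0ℚ ℚ.≤ f n ℚ.+ ½ ℚ.* ε → 0ℚ ℚ.≤ g n ℚ.+ ½ ℚ.* ε → 0ℚ ℚ.≤ f n ℚ.+ g n ℚ.+ ε
  step ε n a b = subst (0ℚ ℚ.≤_)
    (trans (solve 3 (λ x y h → (x :+ h) :+ (y :+ h) := (x :+ y) :+ (h :+ h)) refl (f n) (g n) (½ ℚ.* ε))
           (cong (f n ℚ.+ g n ℚ.+_) (½+½ ε)))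
    (ℚₚ.+-mono-≤ a b)
    where open ℚ-Solver

null-+ : ∀ {f g} → Null f → Null g → Null (λ n → f n ℚ.+ g n)
null-+ {f} {g} (null p) (null q) = null λ ε 0<ε →
  eventually-zip (step ε) (p (½ ℚ.* ε) (0<p*q 0<½ 0<ε)) (q (½ ℚ.* ε) (0<p*q 0<½ 0<ε))
  where
  step : ∀ ε n → ∣ f n ∣ ℚ.≤ ½ ℚ.* ε → ∣ g n ∣ ℚ.≤ ½ ℚ.* ε → ∣ f n ℚ.+ g n ∣ ℚ.≤ ε
  step ε n a b = subst (∣ f n ℚ.+ g n ∣ ℚ.≤_) (½+½ ε)
    (ℚₚ.≤-trans (ℚₚ.∣p+q∣≤∣p∣+∣q∣ (f n) (g n)) (ℚₚ.+-mono-≤ a b))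

nn-* : ∀ {f} k → 0ℚ ℚ.≤ k → NonNegative∞ f → NonNegative∞ (λ n → k ℚ.* f n)
nn-* {f} k 0≤k (nn p) = nn λ ε 0<ε → let (δ , 0<δ , kδ≤ε) = shrink k ε 0<ε in
  eventually-map (step δ ε kδ≤ε) (p δ 0<δ)
  where
  open ℚₚ.≤-Reasoning
  step : ∀ δ ε → ∣ k ∣ ℚ.* δ ℚ.≤ ε → ∀ n → 0ℚ ℚ.≤ f n ℚ.+ δ → 0ℚ ℚ.≤ k ℚ.* f n ℚ.+ ε
  step δ ε kδ≤ε n a = begin
    0ℚ                            ≡⟨ ℚₚ.*-zeroʳ k ⟨
    k ℚ.* 0ℚ                      ≤⟨ *-monoʳ-≤ 0≤k a ⟩
    k ℚ.* (f n ℚ.+ δ)             ≡⟨ ℚₚ.*-distribˡ-+ k (f n) δ ⟩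
    k ℚ.* f n ℚ.+ k ℚ.* δ         ≡⟨ cong (λ x → k ℚ.* f n ℚ.+ x ℚ.* δ) (ℚₚ.0≤p⇒∣p∣≡p 0≤k) ⟨
    k ℚ.* f n ℚ.+ ∣ k ∣ ℚ.* δ     ≤⟨ ℚₚ.+-monoʳ-≤ (k ℚ.* f n) kδ≤ε ⟩
    k ℚ.* f n ℚ.+ ε               ∎

null-* : ∀ {f} k → Null f → Null (λ n → k ℚ.* f n)
null-* {f} k (null p) = null λ ε 0<ε → let (δ , 0<δ , kδ≤ε) = shrink k ε 0<ε in
  eventually-map (step δ ε kδ≤ε) (p δ 0<δ)
  where
  step : ∀ δ ε → ∣ k ∣ ℚ.* δ ℚ.≤ ε → ∀ n → ∣ f n ∣ ℚ.≤ δ → ∣ k ℚ.* f n ∣ ℚ.≤ ε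
  step δ ε kδ≤ε n a = subst (ℚ._≤ ε) (sym (ℚₚ.∣p*q∣≡∣p∣*∣q∣ k (f n)))
    (ℚₚ.≤-trans (*-monoʳ-≤ (ℚₚ.0≤∣p∣ k) a) kδ≤ε)

nn-cancel : ∀ {f} k → 0ℚ ℚ.< k → NonNegative∞ (λ n → k ℚ.* f n) → NonNegative∞ f
nn-cancel {f} k 0<k (nn p) = nn λ ε 0<ε → eventually-map (step ε) (p (k ℚ.* ε) (0<p*q 0<k 0<ε))
  where
  step : ∀ ε n → 0ℚ ℚ.≤ k ℚ.* f n ℚ.+ k ℚ.* ε → 0ℚ ℚ.≤ f n ℚ.+ ε
  step ε n a = ℚₚ.*-cancelˡ-≤-pos k {{ℚ.positive 0<k}}
    (subst₂ ℚ._≤_ (sym (ℚₚ.*-zeroʳ k)) (sym (ℚₚ.*-distribˡ-+ k (f n) ε)) a)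

0<∣p∣ : ∀ {p} → p ≢ 0ℚ → 0ℚ ℚ.< ∣ p ∣
0<∣p∣ {p} p≢0 = ℚₚ.≰⇒> λ ∣p∣≤0 → p≢0 (ℚₚ.∣p∣≡0⇒p≡0 p (ℚₚ.≤-antisym ∣p∣≤0 (ℚₚ.0≤∣p∣ p)))

null-cancel : ∀ {f} k → k ≢ 0ℚ → Null (λ n → k ℚ.* f n) → Null f
null-cancel {f} k k≢0 (null p) = null λ ε 0<ε → eventually-map (step ε) (p (∣ k ∣ ℚ.* ε) (0<p*q 0<∣k∣ 0<ε))
  where
  0<∣k∣ = 0<∣p∣ k≢0
  step : ∀ ε n → ∣ k ℚ.* f n ∣ ℚ.≤ ∣ k ∣ ℚ.* ε → ∣ f n ∣ ℚ.≤ ε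
  step ε n a = ℚₚ.*-cancelˡ-≤-pos ∣ k ∣ {{ℚ.positive 0<∣k∣}}
    (subst (ℚ._≤ ∣ k ∣ ℚ.* ε) (ℚₚ.∣p*q∣≡∣p∣*∣q∣ k (f n)) a)

null-zero : ∀ {f} → (∀ n → f n ≡ 0ℚ) → Null f
null-zero f≗0 = null λ ε 0<ε → 0 , λ n _ → subst (λ x → ∣ x ∣ ℚ.≤ ε) (sym (f≗0 n)) (ℚₚ.<⇒≤ 0<ε)

null⇒nn : ∀ {f} → Null f → NonNegative∞ f
null⇒nn {f} (null p) = nn λ ε 0<ε → eventually-map (step ε 0<ε) (p ε 0<ε)
  where
  step : ∀ ε → 0ℚ ℚ.< ε → ∀ n → ∣ f n ∣ ℚ.≤ ε → 0ℚ ℚ.≤ f n ℚ.+ ε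
  step ε 0<ε n a with ℚₚ.∣p∣≡p∨∣p∣≡-p (f n)
  ... | inj₁ eq = ℚₚ.+-mono-≤ (ℚₚ.∣p∣≡p⇒0≤p eq) (ℚₚ.<⇒≤ 0<ε)
  ... | inj₂ eq = subst (ℚ._≤ f n ℚ.+ ε) (ℚₚ.+-inverseʳ (f n))
                    (ℚₚ.+-monoʳ-≤ (f n) (subst (ℚ._≤ ε) eq a))

nn∧nn⇒null : ∀ {f} → NonNegative∞ f → NonNegative∞ (λ n → ℚ.- f n) → Null f
nn∧nn⇒null {f} (nn p) (nn q) = null λ ε 0<ε → eventually-zip (step ε) (p ε 0<ε) (q ε 0<ε)
  where
  step : ∀ ε n → 0ℚ ℚ.≤ f n ℚ.+ ε → 0ℚ ℚ.≤ ℚ.- f n ℚ.+ ε → ∣ f n ∣ ℚ.≤ ε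
  step ε n a b with ℚₚ.∣p∣≡p∨∣p∣≡-p (f n)
  ... | inj₁ eq = subst (ℚ._≤ ε) (sym eq)
        (subst₂ ℚ._≤_ (ℚₚ.+-identityʳ (f n))
          (solve 2 (λ x e → x :+ (:- x :+ e) := e) refl (f n) ε) (ℚₚ.+-monoʳ-≤ (f n) b))
    where open ℚ-Solver
  ... | inj₂ eq = subst (ℚ._≤ ε) (sym eq)
        (subst₂ ℚ._≤_ (ℚₚ.+-identityʳ (ℚ.- f n))
          (solve 2 (λ x e → :- x :+ (x :+ e) := e) refl (f n) ε) (ℚₚ.+-monoʳ-≤ (ℚ.- f n) a))
    where open ℚ-Solver

-- The balance makes -αp a combination that is nonnegative in the limit, and α can be cancelled. In
-- use, p, q, r, s are t, 1 - t, u, 1 - u in some order and e is a difference that tends to 0.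
squeeze : ∀ {p q r s e : Seq} (α β γ δ : ℚ) → 0ℚ ℚ.< α → 0ℚ ℚ.≤ β → 0ℚ ℚ.≤ γ → 0ℚ ℚ.≤ δ →
          NonNegative∞ q → NonNegative∞ r → NonNegative∞ s → NonNegative∞ e →
          (∀ n → α ℚ.* p n ℚ.+ (β ℚ.* q n ℚ.+ γ ℚ.* r n ℚ.+ δ ℚ.* s n ℚ.+ e n) ≡ 0ℚ) →
          NonNegative∞ (λ n → ℚ.- p n)
squeeze {p} {q} {r} {s} {e} α β γ δ 0<α 0≤β 0≤γ 0≤δ nq nr ns ne balance =
  nn-cancel α 0<α (nn-cong rearrange (nn-+ (nn-+ (nn-+ (nn-* β 0≤β nq) (nn-* γ 0≤γ nr)) (nn-* δ 0≤δ ns)) ne))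
  where
  open ℚ-Solver
  rearrange : ∀ n → β ℚ.* q n ℚ.+ γ ℚ.* r n ℚ.+ δ ℚ.* s n ℚ.+ e n ≡ α ℚ.* (ℚ.- p n)
  rearrange n = trans (solve 2 (λ x y → y := x :+ y :+ :- x) refl (α ℚ.* p n) _)
    (trans (cong (ℚ._- α ℚ.* p n) (balance n))
           (solve 2 (λ a x → con 0ℚ :+ :- (a :* x) := a :* (:- x)) refl α (p n)))

-- Straight segments in the real plane

affine : ℤ → ℤ → ℚ → ℚ
affine a b x = ι a ℚ.+ (ι b ℚ.- ι a) ℚ.* x

affine-difference : ∀ a b x y → affine a b x ℚ.- affine a b y ≡ (ι b ℚ.- ι a) ℚ.* (x ℚ.- y)
affine-difference a b x y = solve 4
  (λ a k x y → (a :+ k :* x) :- (a :+ k :* y) := k :* (x :- y)) refl (ι a) (ι b ℚ.- ι a) x y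
  where open ℚ-Solver

-- One estimate serves both the Cauchy condition of `lerp` and the continuity of straight arcs.
affine-lipschitz : ∀ a b {δ ε} x y → ∣ ι b ℚ.- ι a ∣ ℚ.* δ ℚ.≤ ε → ∣ x ℚ.- y ∣ ℚ.≤ δ →
                   ∣ affine a b x ℚ.- affine a b y ∣ ℚ.≤ ε
affine-lipschitz a b {δ} {ε} x y kδ≤ε p = subst (ℚ._≤ ε)
  (trans (sym (ℚₚ.∣p*q∣≡∣p∣*∣q∣ (ι b ℚ.- ι a) (x ℚ.- y))) (cong ∣_∣ (sym (affine-difference a b x y))))
  (ℚₚ.≤-trans (*-monoʳ-≤ (ℚₚ.0≤∣p∣ (ι b ℚ.- ι a)) p) kδ≤ε)

lerp : ℤ → ℤ → ℝ → ℝ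
lerp a b t = record
  { seq    = λ n → affine a b (seq t n)
  ; cauchy = λ ε 0<ε → let (δ , 0<δ , kδ≤ε) = shrink (ι b ℚ.- ι a) ε 0<ε
                           (N , p) = cauchy t δ 0<δ
                       in N , λ m n N≤m N≤n → affine-lipschitz a b (seq t m) (seq t n) kδ≤ε (p m n N≤m N≤n)
  }

along : Segment → UnitInterval → Plane
along ((x , y) , (x′ , y′)) t = lerp x x′ (value t) , lerp y y′ (value t)

nn-lower : ∀ t → NonNegative∞ (seq (value t))
nn-lower t = nn (lower t)

nn-upper : ∀ t → NonNegative∞ (λ n → 1ℚ ℚ.- seq (value t) n)
nn-upper t = nn λ ε 0<ε → eventually-map (λ n p → subst₂ ℚ._≤_ (ℚₚ.+-inverseʳ (seq (value t) n))
    (solve 2 (λ x e → con 1ℚ :+ e :- x := (con 1ℚ :- x) :+ e) refl (seq (value t) n) ε)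
    (ℚₚ.+-monoˡ-≤ (ℚ.- seq (value t) n) p)) (upper t ε 0<ε)
  where open ℚ-Solver

-- Interiority is only a negation and yields no positive lower bound on t. What it does yield is a
-- refutation of t ≤ 0.
interior⇒≰0 : ∀ t → Interior t → ¬ NonNegative∞ (λ n → ℚ.- seq (value t) n)
interior⇒≰0 t (t≉0 , _) p = t≉0 (null⁻¹ (null-cong (λ n → sym (ℚₚ.+-identityʳ _)) (nn∧nn⇒null (nn-lower t) p)))

interior⇒≱1 : ∀ t → Interior t → ¬ NonNegative∞ (λ n → ℚ.- (1ℚ ℚ.- seq (value t) n))
interior⇒≱1 t (_ , t≉1) p = t≉1 (null⁻¹ (nn∧nn⇒null (nn-cong (λ n → minus-swap 1ℚ (seq (value t) n)) p)
                                              (nn-cong (λ n → sym (minus-swap (seq (value t) n) 1ℚ)) (nn-upper t))))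
  where
  minus-swap : ∀ x y → ℚ.- (x ℚ.- y) ≡ y ℚ.- x
  minus-swap = solve 2 (λ x y → :- (x :- y) := y :- x) refl
    where open ℚ-Solver

0≤q-p : ∀ {p q} → p ℚ.≤ q → 0ℚ ℚ.≤ q ℚ.- p
0≤q-p {p} {q} p≤q = subst (ℚ._≤ q ℚ.- p) (ℚₚ.+-inverseʳ p) (ℚₚ.+-monoˡ-≤ (ℚ.- p) p≤q)

0<q-p : ∀ {p q} → p ℚ.< q → 0ℚ ℚ.< q ℚ.- p
0<q-p {p} {q} p<q = subst (ℚ._< q ℚ.- p) (ℚₚ.+-inverseʳ p) (ℚₚ.+-monoˡ-< (ℚ.- p) p<q)

-- c − L and R − c are the nonnegative combinations (c − a₁)(1 − t) + (c − a₂)t and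
-- (b₁ − c)(1 − u) + (b₂ − c)u, so L ≈ R makes every term vanish, also the one with a
-- positive coefficient.
intervals-disjoint : ∀ a₁ a₂ b₁ b₂ c → a₁ ℤ.≤ c → a₂ ℤ.≤ c → c ℤ.≤ b₁ → c ℤ.≤ b₂ →
  (a₁ ℤ.< c ⊎ a₂ ℤ.< c) ⊎ (c ℤ.< b₁ ⊎ c ℤ.< b₂) →
  ∀ t u → Interior t → Interior u → ¬ (lerp a₁ a₂ (value t) ≈ lerp b₁ b₂ (value u))
intervals-disjoint a₁ a₂ b₁ b₂ c a₁≤c a₂≤c c≤b₁ c≤b₂ strict t u t° u° L≈R = conclude strict
  where
  open ℚ-Solver
  A₁ = ι c ℚ.- ι a₁
  A₂ = ι c ℚ.- ι a₂
  B₁ = ι b₁ ℚ.- ι c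
  B₂ = ι b₂ ℚ.- ι c
  0≤A₁ = 0≤q-p (ι-mono-≤ a₁≤c)
  0≤A₂ = 0≤q-p (ι-mono-≤ a₂≤c)
  0≤B₁ = 0≤q-p (ι-mono-≤ c≤b₁)
  0≤B₂ = 0≤q-p (ι-mono-≤ c≤b₂)
  T U : Seq
  T = seq (value t)
  U = seq (value u)
  E : Seq
  E n = affine a₁ a₂ (T n) ℚ.- affine b₁ b₂ (U n)
  0≤E : NonNegative∞ E
  0≤E = null⇒nn (null L≈R)
  conclude : ¬ ((a₁ ℤ.< c ⊎ a₂ ℤ.< c) ⊎ (c ℤ.< b₁ ⊎ c ℤ.< b₂))
  conclude (inj₁ (inj₁ a₁<c)) = interior⇒≱1 t t° (squeeze A₁ A₂ B₁ B₂
    (0<q-p (ι-mono-< a₁<c)) 0≤A₂ 0≤B₁ 0≤B₂ (nn-lower t) (nn-upper u) (nn-lower u) 0≤E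
    λ n → solve 7 (λ a₁ a₂ b₁ b₂ c t u →
      (c :- a₁) :* (con 1ℚ :- t) :+ ((c :- a₂) :* t :+ (b₁ :- c) :* (con 1ℚ :- u) :+ (b₂ :- c) :* u
        :+ ((a₁ :+ (a₂ :- a₁) :* t) :- (b₁ :+ (b₂ :- b₁) :* u))) := con 0ℚ) refl
      (ι a₁) (ι a₂) (ι b₁) (ι b₂) (ι c) (T n) (U n))
  conclude (inj₁ (inj₂ a₂<c)) = interior⇒≰0 t t° (squeeze A₂ A₁ B₁ B₂
    (0<q-p (ι-mono-< a₂<c)) 0≤A₁ 0≤B₁ 0≤B₂ (nn-upper t) (nn-upper u) (nn-lower u) 0≤E
    λ n → solve 7 (λ a₁ a₂ b₁ b₂ c t u →
      (c :- a₂) :* t :+ ((c :- a₁) :* (con 1ℚ :- t) :+ (b₁ :- c) :* (con 1ℚ :- u) :+ (b₂ :- c) :* u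
        :+ ((a₁ :+ (a₂ :- a₁) :* t) :- (b₁ :+ (b₂ :- b₁) :* u))) := con 0ℚ) refl
      (ι a₁) (ι a₂) (ι b₁) (ι b₂) (ι c) (T n) (U n))
  conclude (inj₂ (inj₁ c<b₁)) = interior⇒≱1 u u° (squeeze B₁ A₁ A₂ B₂
    (0<q-p (ι-mono-< c<b₁)) 0≤A₁ 0≤A₂ 0≤B₂ (nn-upper t) (nn-lower t) (nn-lower u) 0≤E
    λ n → solve 7 (λ a₁ a₂ b₁ b₂ c t u →
      (b₁ :- c) :* (con 1ℚ :- u) :+ ((c :- a₁) :* (con 1ℚ :- t) :+ (c :- a₂) :* t :+ (b₂ :- c) :* u
        :+ ((a₁ :+ (a₂ :- a₁) :* t) :- (b₁ :+ (b₂ :- b₁) :* u))) := con 0ℚ) refl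
      (ι a₁) (ι a₂) (ι b₁) (ι b₂) (ι c) (T n) (U n))
  conclude (inj₂ (inj₂ c<b₂)) = interior⇒≰0 u u° (squeeze B₂ A₁ A₂ B₁
    (0<q-p (ι-mono-< c<b₂)) 0≤A₁ 0≤A₂ 0≤B₁ (nn-upper t) (nn-lower t) (nn-upper u) 0≤E
    λ n → solve 7 (λ a₁ a₂ b₁ b₂ c t u →
      (b₂ :- c) :* u :+ ((c :- a₁) :* (con 1ℚ :- t) :+ (c :- a₂) :* t :+ (b₁ :- c) :* (con 1ℚ :- u)
        :+ ((a₁ :+ (a₂ :- a₁) :* t) :- (b₁ :+ (b₂ :- b₁) :* u))) := con 0ℚ) refl
      (ι a₁) (ι a₂) (ι b₁) (ι b₂) (ι c) (T n) (U n))

ι-∙ : ∀ f p → ι (f ∙ p) ≡ ι (proj₁ f) ℚ.* ι (proj₁ p) ℚ.+ ι (proj₂ f) ℚ.* ι (proj₂ p)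
ι-∙ (a , b) (x , y) = trans (ι-+ (a ℤ.* x) (b ℤ.* y)) (cong₂ ℚ._+_ (ι-* a x) (ι-* b y))

affine-∙ : ∀ f p q x → affine (f ∙ p) (f ∙ q) x ≡
  ι (proj₁ f) ℚ.* affine (proj₁ p) (proj₁ q) x ℚ.+ ι (proj₂ f) ℚ.* affine (proj₂ p) (proj₂ q) x
affine-∙ f p q x rewrite ι-∙ f p | ι-∙ f q = solve 7 (λ a b x y x′ y′ t →
    (a :* x :+ b :* y) :+ ((a :* x′ :+ b :* y′) :- (a :* x :+ b :* y)) :* t
    := a :* (x :+ (x′ :- x) :* t) :+ b :* (y :+ (y′ :- y) :* t)) refl
  (ι (proj₁ f)) (ι (proj₂ f)) (ι (proj₁ p)) (ι (proj₂ p)) (ι (proj₁ q)) (ι (proj₂ q)) x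
  where open ℚ-Solver

-- Applying `f` turns a common point of the segments into a common value of two intervals on
-- opposite sides of c.
separatedBy⇒disjoint : ∀ {f c σ τ} → SeparatedBy f c σ τ →
  ∀ t u → Interior t → Interior u → ¬ (along σ t ≈₂ along τ u)
separatedBy⇒disjoint {f} {c} {p , q} {p′ , q′} (separatedBy b₁ b₂ a₁ a₂ s) t u t° u° (x≈ , y≈) =
  intervals-disjoint (f ∙ p) (f ∙ q) (f ∙ p′) (f ∙ q′) c b₁ b₂ a₁ a₂ s t u t° u°
    (null⁻¹ (null-cong evaluate (null-+ (null-* (ι (proj₁ f)) (null x≈)) (null-* (ι (proj₂ f)) (null y≈)))))
  where
  open ℚ-Solver
  X Y X′ Y′ : Seq
  X n = affine (proj₁ p) (proj₁ q) (seq (value t) n)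
  Y n = affine (proj₂ p) (proj₂ q) (seq (value t) n)
  X′ n = affine (proj₁ p′) (proj₁ q′) (seq (value u) n)
  Y′ n = affine (proj₂ p′) (proj₂ q′) (seq (value u) n)
  evaluate : ∀ n → ι (proj₁ f) ℚ.* (X n ℚ.- X′ n) ℚ.+ ι (proj₂ f) ℚ.* (Y n ℚ.- Y′ n)
           ≡ affine (f ∙ p) (f ∙ q) (seq (value t) n) ℚ.- affine (f ∙ p′) (f ∙ q′) (seq (value u) n)
  evaluate n rewrite affine-∙ f p q (seq (value t) n) | affine-∙ f p′ q′ (seq (value u) n) =
    solve 6 (λ a b x x′ y y′ →
      a :* (x :- x′) :+ b :* (y :- y′) := (a :* x :+ b :* y) :- (a :* x′ :+ b :* y′)) refl
      (ι (proj₁ f)) (ι (proj₂ f)) (X n) (X′ n) (Y n) (Y′ n)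

affine-scale : ∀ k a b x → affine (+ k ℤ.* a) (+ k ℤ.* b) x ≡ ι (+ k) ℚ.* affine a b x
affine-scale k a b x rewrite ι-* (+ k) a | ι-* (+ k) b = solve 4
  (λ k a b x → k :* a :+ (k :* b :- k :* a) :* x := k :* (a :+ (b :- a) :* x)) refl (ι (+ k)) (ι a) (ι b) x
  where open ℚ-Solver

affine-scale-difference : ∀ k a b a′ b′ x y →
  affine (+ k ℤ.* a) (+ k ℤ.* b) x ℚ.- affine (+ k ℤ.* a′) (+ k ℤ.* b′) y
  ≡ ι (+ k) ℚ.* (affine a b x ℚ.- affine a′ b′ y)
affine-scale-difference k a b a′ b′ x y rewrite affine-scale k a b x | affine-scale k a′ b′ y =
  solve 3 (λ k v w → k :* v :- k :* w := k :* (v :- w)) refl (ι (+ k)) (affine a b x) (affine a′ b′ y)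
  where open ℚ-Solver

shrink-meeting : ∀ k .{{_ : ℕ.NonZero k}} σ τ t u →
  along (k • σ) t ≈₂ along (k • τ) u → along σ t ≈₂ along τ u
shrink-meeting (suc k) ((a , b) , (c , d)) ((a′ , b′) , (c′ , d′)) t u (x≈ , y≈) =
  unscale a c a′ c′ x≈ , unscale b d b′ d′ y≈
  where
  unscale : ∀ v w v′ w′ →
    lerp (+ suc k ℤ.* v) (+ suc k ℤ.* w) (value t) ≈ lerp (+ suc k ℤ.* v′) (+ suc k ℤ.* w′) (value u) →
    lerp v w (value t) ≈ lerp v′ w′ (value u)
  unscale v w v′ w′ eq = null⁻¹ (null-cancel (ι (+ suc k)) (ι≢0 λ ())
    (null-cong (λ n → affine-scale-difference (suc k) v w v′ w′ (seq (value t) n) (seq (value u) n)) (null eq)))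

enlarge-meeting : ∀ k σ τ t u →
  along σ t ≈₂ along τ u → along (k • σ) t ≈₂ along (k • τ) u
enlarge-meeting k ((a , b) , (c , d)) ((a′ , b′) , (c′ , d′)) t u (x≈ , y≈) =
  scale a c a′ c′ x≈ , scale b d b′ d′ y≈
  where
  scale : ∀ v w v′ w′ → lerp v w (value t) ≈ lerp v′ w′ (value u) →
    lerp (+ k ℤ.* v) (+ k ℤ.* w) (value t) ≈ lerp (+ k ℤ.* v′) (+ k ℤ.* w′) (value u)
  scale v w v′ w′ eq = null⁻¹ (null-cong
    (λ n → sym (affine-scale-difference k v w v′ w′ (seq (value t) n) (seq (value u) n)))
    (null-* (ι (+ k)) (null eq)))

ι-minus : ∀ x y → ι (x ℤ.- y) ≡ ι x ℚ.- ι y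
ι-minus x y = trans (ι-+ x (ℤ.- y)) (cong (ι x ℚ.+_) (ι-neg y))

ι-perp : ∀ a b c d → ι (perp (a , b) ∙ (c , d)) ≡ ι a ℚ.* ι d ℚ.- ι b ℚ.* ι c
ι-perp a b c d rewrite ι-∙ (perp (a , b)) (c , d) | ι-neg b =
  solve 4 (λ a b c d → :- b :* c :+ a :* d := a :* d :- b :* c) refl (ι a) (ι b) (ι c) (ι d)
  where open ℚ-Solver

-- Cramer's rule: the combination in `eliminate` cancels u and u′ and leaves the cross product times
-- t - t′.
transversal⇒unique : ∀ σ τ → Transversal σ τ → ∀ t u t′ u′ →
  along σ t ≈₂ along τ u → along σ t′ ≈₂ along τ u′ → along σ t ≈₂ along σ t′
transversal⇒unique σ@((a , b) , (c , d)) τ@((a′ , b′) , (c′ , d′)) K≢0 t u t′ u′ (x≈ , y≈) (x≈′ , y≈′) =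
  spread a c , spread b d
  where
  open ℚ-Solver
  T = seq (value t)
  T′ = seq (value t′)
  U = seq (value u)
  U′ = seq (value u′)
  K : ℤ
  K = perp (direction σ) ∙ direction τ
  eliminate : ∀ n →
    (ι d′ ℚ.- ι b′) ℚ.* (affine a c (T n) ℚ.- affine a′ c′ (U n)) ℚ.+
    ((ι b′ ℚ.- ι d′) ℚ.* (affine a c (T′ n) ℚ.- affine a′ c′ (U′ n)) ℚ.+
    ((ι a′ ℚ.- ι c′) ℚ.* (affine b d (T n) ℚ.- affine b′ d′ (U n)) ℚ.+
     (ι c′ ℚ.- ι a′) ℚ.* (affine b d (T′ n) ℚ.- affine b′ d′ (U′ n))))
    ≡ ι K ℚ.* (T n ℚ.- T′ n)
  eliminate n
    rewrite ι-perp (c ℤ.- a) (d ℤ.- b) (c′ ℤ.- a′) (d′ ℤ.- b′)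
          | ι-minus c a | ι-minus d b | ι-minus c′ a′ | ι-minus d′ b′ =
    solve 12 (λ a b c d a′ b′ c′ d′ t t′ u u′ →
      (d′ :- b′) :* ((a :+ (c :- a) :* t) :- (a′ :+ (c′ :- a′) :* u)) :+
      ((b′ :- d′) :* ((a :+ (c :- a) :* t′) :- (a′ :+ (c′ :- a′) :* u′)) :+
      ((a′ :- c′) :* ((b :+ (d :- b) :* t) :- (b′ :+ (d′ :- b′) :* u)) :+
       (c′ :- a′) :* ((b :+ (d :- b) :* t′) :- (b′ :+ (d′ :- b′) :* u′))))
      := ((c :- a) :* (d′ :- b′) :- (d :- b) :* (c′ :- a′)) :* (t :- t′)) refl
      (ι a) (ι b) (ι c) (ι d) (ι a′) (ι b′) (ι c′) (ι d′) (T n) (T′ n) (U n) (U′ n)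
  t≈t′ : Null (λ n → T n ℚ.- T′ n)
  t≈t′ = null-cancel (ι K) (ι≢0 K≢0) (null-cong eliminate
    (null-+ (null-* (ι d′ ℚ.- ι b′) (null x≈)) (null-+ (null-* (ι b′ ℚ.- ι d′) (null x≈′))
    (null-+ (null-* (ι a′ ℚ.- ι c′) (null y≈)) (null-* (ι c′ ℚ.- ι a′) (null y≈′))))))
  spread : ∀ v w → lerp v w (value t) ≈ lerp v w (value t′)
  spread v w = null⁻¹ (null-cong (λ n → sym (affine-difference v w (T n) (T′ n))) (null-* (ι w ℚ.- ι v) t≈t′))

-- Straight arcs and vertices in the real plane

embed : Point → Plane
embed (x , y) = fromℚ (ι x) , fromℚ (ι y)

ι-distinct : ∀ {x y} → x ≢ y → ι y ℚ.- ι x ≢ 0ℚ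
ι-distinct {x} {y} x≢y eq = ι≢0 (λ y-x≡0 → x≢y (sym (ℤₚ.i-j≡0⇒i≡j y x y-x≡0))) (trans (ι-minus y x) eq)

straight : (σ : Segment) → proj₁ σ ≢ proj₂ σ → SimpleArc (embed (proj₁ σ)) (embed (proj₂ σ))
straight σ@((a , b) , (c , d)) p≢q = record
  { γ          = along σ
  ; continuous = λ t ε 0<ε →
      let (δ , 0<δ , kδ≤ε) = shrink (ι c ℚ.- ι a) ε 0<ε
          (δ′ , 0<δ′ , kδ′≤ε) = shrink (ι d ℚ.- ι b) ε 0<ε
      in δ ℚ.⊓ δ′ , 0<⊓ 0<δ 0<δ′ , λ s (N , p) →
         (N , λ n N≤n → affine-lipschitz a c (seq (value s) n) (seq (value t) n) kδ≤ε
                          (ℚₚ.≤-trans (p n N≤n) (ℚₚ.p⊓q≤p δ δ′))) ,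
         (N , λ n N≤n → affine-lipschitz b d (seq (value s) n) (seq (value t) n) kδ′≤ε
                          (ℚₚ.≤-trans (p n N≤n) (ℚₚ.p⊓q≤q δ δ′)))
  ; injective  = injective
  ; start      = at-start a c , at-start b d
  ; end        = at-end a c , at-end b d
  }
  where
  open ℚ-Solver
  0<⊓ : ∀ {p q} → 0ℚ ℚ.< p → 0ℚ ℚ.< q → 0ℚ ℚ.< p ℚ.⊓ q
  0<⊓ {p} {q} 0<p 0<q with ℚₚ.⊓-sel p q
  ... | inj₁ eq = subst (0ℚ ℚ.<_) (sym eq) 0<p
  ... | inj₂ eq = subst (0ℚ ℚ.<_) (sym eq) 0<q
  at-start : ∀ v w → lerp v w 0ℝ ≈ fromℚ (ι v)
  at-start v w = null⁻¹ (null-zero λ n →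
    solve 2 (λ v w → (v :+ (w :- v) :* con 0ℚ) :- v := con 0ℚ) refl (ι v) (ι w))
  at-end : ∀ v w → lerp v w 1ℝ ≈ fromℚ (ι w)
  at-end v w = null⁻¹ (null-zero λ n →
    solve 2 (λ v w → (v :+ (w :- v) :* con 1ℚ) :- w := con 0ℚ) refl (ι v) (ι w))
  recover : ∀ {v w} → v ≢ w → ∀ s t → lerp v w s ≈ lerp v w t → s ≈ t
  recover {v} {w} v≢w s t eq = null⁻¹ (null-cancel (ι w ℚ.- ι v) (ι-distinct v≢w)
    (null-cong (λ n → affine-difference v w (seq s n) (seq t n)) (null eq)))
  injective : ∀ s t → along σ s ≈₂ along σ t → value s ≈ value t
  -- The endpoints differ in some coordinate; there the arc is affine with nonzero slope, so the
  -- parameter can be recovered.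
  injective s t (x≈ , y≈) with a ℤ.≟ c
  ... | no a≢c = recover a≢c (value s) (value t) x≈
  ... | yes a≡c = recover (λ b≡d → p≢q (cong₂ _,_ a≡c b≡d)) (value s) (value t) y≈

-- Supplies an interior parameter at which the degenerate segment of a vertex is attained, so that
-- disjointness of open segments applies to vertices too.
midpoint : UnitInterval
midpoint = mkI (fromℚ ½)
  (λ ε 0<ε → 0 , λ _ _ → ℚₚ.+-mono-≤ (ℚₚ.nonNegative⁻¹ ½) (ℚₚ.<⇒≤ 0<ε))
  (λ ε 0<ε → 0 , λ _ _ → ℚₚ.+-mono-≤ {½} {1ℚ} (from-yes (½ ℚ.≤? 1ℚ)) (ℚₚ.<⇒≤ 0<ε))

midpoint-interior : Interior midpoint
midpoint-interior = (λ eq → from-no (½ ℚ.≤? ¼) (large {0ℚ} eq)) , (λ eq → from-no (½ ℚ.≤? ¼) (large {1ℚ} eq))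
  where
  ¼ = ½ ℚ.* ½
  large : ∀ {x} → fromℚ ½ ≈ fromℚ x → ∣ ½ ℚ.- x ∣ ℚ.≤ ¼
  large eq = let (N , p) = eq ¼ (ℚₚ.positive⁻¹ ¼) in p N ℕₚ.≤-refl

affine-constant : ∀ a x → ι a ≡ affine a a x
affine-constant a x = solve 2 (λ a x → a := a :+ (a :- a) :* x) refl (ι a) x
  where open ℚ-Solver

meets-embed : ∀ σ t p → along σ t ≈₂ embed p → along σ t ≈₂ along (p , p) midpoint
meets-embed ((a , b) , (c , d)) t (x , y) (x≈ , y≈) =
  null⁻¹ (null-cong (λ n → cong (λ z → affine a c (seq (value t) n) ℚ.- z) (affine-constant x ½)) (null x≈)) ,
  null⁻¹ (null-cong (λ n → cong (λ z → affine b d (seq (value t) n) ℚ.- z) (affine-constant y ½)) (null y≈))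

embed-meets : ∀ p q → embed p ≈₂ embed q → along (p , p) midpoint ≈₂ along (q , q) midpoint
embed-meets (x , y) (x′ , y′) (x≈ , y≈) =
  null⁻¹ (null-cong (λ n → cong₂ ℚ._-_ (affine-constant x ½) (affine-constant x′ ½)) (null x≈)) ,
  null⁻¹ (null-cong (λ n → cong₂ ℚ._-_ (affine-constant y ½) (affine-constant y′ ½)) (null y≈))

≈₂-sym : ∀ p q → p ≈₂ q → q ≈₂ p
≈₂-sym (x , y) (x′ , y′) (x≈ , y≈) = ≈-sym x x′ x≈ , ≈-sym y y′ y≈
  where
  open ℚ-Solver
  ≈-sym : ∀ x y → x ≈ y → y ≈ x
  ≈-sym x y x≈y = null⁻¹ (null-cong (λ n →
    solve 2 (λ x y → con (ℚ.- 1ℚ) :* (x :- y) := y :- x) refl (seq x n) (seq y n)) (null-* (ℚ.- 1ℚ) (null x≈y)))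

≈₂-refl : ∀ p → p ≈₂ p
≈₂-refl (x , y) = ≈-refl x , ≈-refl y
  where
  ≈-refl : ∀ x → x ≈ x
  ≈-refl x = null⁻¹ (null-zero λ n → ℚₚ.+-inverseʳ (seq x n))

-- Scaling of integer points and segments

∙-· : ∀ f k p → f ∙ (k · p) ≡ + k ℤ.* (f ∙ p)
∙-· (a , b) k (x , y) = solve 5
  (λ a b k x y → a :* (k :* x) :+ b :* (k :* y) := k :* (a :* x :+ b :* y)) refl a b (+ k) x y
  where open ℤ-Solver

·-· : ∀ k l p → k · (l · p) ≡ (k ℕ.* l) · p
·-· k l (x , y) = cong₂ _,_ (assoc x) (assoc y)
  where
  assoc : ∀ z → + k ℤ.* (+ l ℤ.* z) ≡ + (k ℕ.* l) ℤ.* z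
  assoc z = trans (sym (ℤₚ.*-assoc (+ k) (+ l) z)) (cong (ℤ._* z) (sym (ℤₚ.pos-* k l)))

•-• : ∀ k l σ → k • (l • σ) ≡ (k ℕ.* l) • σ
•-• k l (p , q) = cong₂ _,_ (·-· k l p) (·-· k l q)

-- The cross product is bilinear, so it is multiplied by kl.
transversal-scale : ∀ k .{{_ : ℕ.NonZero k}} l .{{_ : ℕ.NonZero l}} σ τ →
  Transversal σ τ → Transversal (k • σ) (l • τ)
transversal-scale (suc k) (suc l) ((a , b) , (c , d)) ((a′ , b′) , (c′ , d′)) K≢0 eq =
  [ (λ ()) , K≢0 ]′ (ℤₚ.i*j≡0⇒i≡0∨j≡0 (+ suc k ℤ.* + suc l) (trans (sym (homogeneous (+ suc k) (+ suc l))) eq))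
  where
  homogeneous : ∀ k l →
    (ℤ.- (k ℤ.* d ℤ.+ ℤ.- (k ℤ.* b))) ℤ.* (l ℤ.* c′ ℤ.+ ℤ.- (l ℤ.* a′))
      ℤ.+ (k ℤ.* c ℤ.+ ℤ.- (k ℤ.* a)) ℤ.* (l ℤ.* d′ ℤ.+ ℤ.- (l ℤ.* b′))
    ≡ k ℤ.* l ℤ.* ((ℤ.- (d ℤ.+ ℤ.- b)) ℤ.* (c′ ℤ.+ ℤ.- a′) ℤ.+ (c ℤ.+ ℤ.- a) ℤ.* (d′ ℤ.+ ℤ.- b′))
  homogeneous k l = solve 10
    (λ k l a b c d a′ b′ c′ d′ →
      (:- (k :* d :+ :- (k :* b))) :* (l :* c′ :+ :- (l :* a′))
        :+ (k :* c :+ :- (k :* a)) :* (l :* d′ :+ :- (l :* b′))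
      := k :* l :* ((:- (d :+ :- b)) :* (c′ :+ :- a′) :+ (c :+ :- a) :* (d′ :+ :- b′))) refl
    k l a b c d a′ b′ c′ d′
    where open ℤ-Solver

x≤k*x : ∀ k .{{_ : ℕ.NonZero k}} {x} → 0ℤ ℤ.≤ x → x ℤ.≤ + k ℤ.* x
x≤k*x (suc k) {x} 0≤x = subst (ℤ._≤ + suc k ℤ.* x) (ℤₚ.*-identityˡ x)
  (ℤₚ.*-monoʳ-≤-nonNeg x {{ℤ.nonNegative 0≤x}} {1ℤ} {+ suc k} (ℤ.+≤+ (ℕ.s≤s ℕ.z≤n)))

-- On the endpoints of τ the functional is at least c ≥ 0, so multiplying by k ≥ 1 does not lower
-- its values.
separatedBy-enlarge : ∀ k .{{_ : ℕ.NonZero k}} {f c σ τ} → 0ℤ ℤ.≤ c →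
  SeparatedBy f c σ τ → SeparatedBy f c σ (k • τ)
separatedBy-enlarge k {f} {c} {σ} {p , q} 0≤c (separatedBy b₁ b₂ a₁ a₂ s) =
  separatedBy b₁ b₂ (ℤₚ.≤-trans a₁ (grow p a₁)) (ℤₚ.≤-trans a₂ (grow q a₂)) (strict s)
  where
  grow : ∀ r → c ℤ.≤ f ∙ r → f ∙ r ℤ.≤ f ∙ (k · r)
  grow r a = subst (f ∙ r ℤ.≤_) (sym (∙-· f k r)) (x≤k*x k (ℤₚ.≤-trans 0≤c a))
  strict : (f ∙ proj₁ σ ℤ.< c ⊎ f ∙ proj₂ σ ℤ.< c) ⊎ (c ℤ.< f ∙ p ⊎ c ℤ.< f ∙ q) →
           (f ∙ proj₁ σ ℤ.< c ⊎ f ∙ proj₂ σ ℤ.< c) ⊎ (c ℤ.< f ∙ (k · p) ⊎ c ℤ.< f ∙ (k · q))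
  strict (inj₁ l)        = inj₁ l
  strict (inj₂ (inj₁ l)) = inj₂ (inj₁ (ℤₚ.<-≤-trans l (grow p a₁)))
  strict (inj₂ (inj₂ l)) = inj₂ (inj₂ (ℤₚ.<-≤-trans l (grow q a₂)))

-- Layers

place : ℕ → Shape → Segment
place q s = 3 ^ q • shape s

place-+ : ∀ q k s → place (q ℕ.+ k) s ≡ 3 ^ q • (3 ^ k • shape s)
place-+ q k s = trans (cong (_• shape s) (ℕₚ.^-distribˡ-+-* 3 q k)) (sym (•-• (3 ^ q) (3 ^ k) (shape s)))

3^≢0 : ∀ q → ℕ.NonZero (3 ^ q)
3^≢0 q = ℕₚ.m^n≢0 3 q

-- Division by 3^q moves `s` to layer 0. Of the remaining factor on `s′`, 27 is covered by the
-- finite check and 3^k by enlargement.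
far-disjoint : ∀ q k s s′ t u → Interior t → Interior u →
  ¬ (along (place q s) t ≈₂ along (place (q ℕ.+ (k ℕ.+ 3)) s′) u)
far-disjoint q k s s′ t u t° u° meet =
  let (f , sep) = Any.satisfied (far-shapes-separable s s′) in
  separatedBy⇒disjoint (separatedBy-enlarge (3 ^ k) {{3^≢0 k}} (ℤₚ.i≤i⊔j 0ℤ _) sep) t u t° u°
    (shrink-meeting (3 ^ q) {{3^≢0 q}} (shape s) (3 ^ k • (27 • shape s′)) t u
      (subst (λ τ → along (place q s) t ≈₂ along τ u) eq meet))
  where
  eq : place (q ℕ.+ (k ℕ.+ 3)) s′ ≡ 3 ^ q • (3 ^ k • (27 • shape s′))
  eq = trans (place-+ q (k ℕ.+ 3) s′) (cong (3 ^ q •_) (place-+ k 3 s′))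

-- Here `s′` may lie up to two layers below `s`. Multiplying by 9 first makes both scales multiples
-- of 3^q, which is then divided out.
near-disjoint : ∀ q q′ o s s′ → q′ ℕ.+ 2 ≡ q ℕ.+ toℕ o → Cleared s s′ o →
  ∀ t u → Interior t → Interior u → ¬ (along (place q s) t ≈₂ along (place q′ s′) u)
near-disjoint q q′ o s s′ q′+2≡q+o clear t u t° u° meet =
  let (f , sep) = Any.satisfied (Cleared.separation clear) in
  separatedBy⇒disjoint sep t u t° u°
    (shrink-meeting (3 ^ q) {{3^≢0 q}} (9 • shape s) (3 ^ toℕ o • shape s′) t u
      (subst₂ (λ σ τ → along σ t ≈₂ along τ u)
        (trans (times-9 q s) (place-+ q 2 s))
        (trans (times-9 q′ s′) (trans (cong (λ k → place k s′) q′+2≡q+o) (place-+ q (toℕ o) s′)))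
        (enlarge-meeting 9 (place q s) (place q′ s′) t u meet)))
  where
  times-9 : ∀ q s → 9 • place q s ≡ place (q ℕ.+ 2) s
  times-9 q s = trans (•-• 9 (3 ^ q) (shape s)) (cong (_• shape s)
    (trans (ℕₚ.*-comm 9 (3 ^ q)) (sym (ℕₚ.^-distribˡ-+-* 3 q 2))))

+3-gap : ∀ {q q′} → q ℕ.+ 3 ℕ.≤ q′ → q ℕ.+ (q′ ℕ.∸ (q ℕ.+ 3) ℕ.+ 3) ≡ q′
+3-gap {q} {q′} q+3≤q′ =
  trans (cong (q ℕ.+_) (ℕₚ.+-comm _ 3)) (trans (sym (ℕₚ.+-assoc q 3 _)) (ℕₚ.m+[n∸m]≡n q+3≤q′))

-- Gaps of three or more layers, in either direction, are excluded by `far-disjoint`, which leaves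
-- five offsets. Every incidence of the drawing is reduced to the finite tables through this lemma.
meeting-offset : ∀ q q′ s s′ t u → Interior t → Interior u →
  along (place q s) t ≈₂ along (place q′ s′) u →
  ∃[ o ] (q′ ℕ.+ 2 ≡ q ℕ.+ toℕ o × ¬ Cleared s s′ o)
meeting-offset q q′ s s′ t u t° u° meet with q ℕ.+ 3 ℕ.≤? q′ | q′ ℕ.+ 3 ℕ.≤? q
... | yes q+3≤q′ | _ = contradiction
        (subst (λ k → along (place q s) t ≈₂ along (place k s′) u) (sym (+3-gap q+3≤q′)) meet)
        (far-disjoint q (q′ ℕ.∸ (q ℕ.+ 3)) s s′ t u t° u°)
... | no _ | yes q′+3≤q = contradiction
        (subst (λ k → along (place q′ s′) u ≈₂ along (place k s) t) (sym (+3-gap q′+3≤q))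
          (≈₂-sym (along (place q s) t) (along (place q′ s′) u) meet))
        (far-disjoint q′ (q ℕ.∸ (q′ ℕ.+ 3)) s′ s u t u° t°)
... | no q+3≰q′ | no q′+3≰q =
  o , eq , λ clear → near-disjoint q q′ o s s′ eq clear t u t° u° meet
  where
  q≤q′+2 : q ℕ.≤ q′ ℕ.+ 2
  q≤q′+2 = ℕₚ.≤-pred (subst (q ℕ.<_) (ℕₚ.+-suc q′ 2) (ℕₚ.≰⇒> q′+3≰q))
  bound : q′ ℕ.+ 2 ℕ.∸ q ℕ.< 5
  bound = ℕₚ.+-cancelˡ-< q _ 5 (subst₂ ℕ._<_ (sym (ℕₚ.m+[n∸m]≡n q≤q′+2)) (ℕₚ.+-assoc q 3 2)
            (ℕₚ.+-monoˡ-< 2 (ℕₚ.≰⇒> q+3≰q′)))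
  o : Fin 5
  o = fromℕ< bound
  eq : q′ ℕ.+ 2 ≡ q ℕ.+ toℕ o
  eq = sym (trans (cong (q ℕ.+_) (Finₚ.toℕ-fromℕ< bound)) (ℕₚ.m+[n∸m]≡n q≤q′+2))

-- Numbering of the vertices, layer by layer outwards

layer : ℕ → ℕ
layer m = m / 6

class : ℕ → Fin 6
class m = m mod 6

index : ℕ → Fin 6 → ℕ
index q r = toℕ r ℕ.+ q ℕ.* 6

index-layer-class : ∀ m → index (layer m) (class m) ≡ m
index-layer-class m = trans (cong (ℕ._+ m / 6 ℕ.* 6) (Finₚ.toℕ-fromℕ< (DivMod.m%n<n m 6)))
                            (sym (DivMod.m≡m%n+[m/n]*n m 6))

layer-index : ∀ q r → layer (index q r) ≡ q
layer-index q r = trans (DivMod.+-distrib-/-∣ʳ (toℕ r) (n∣m*n q))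
  (cong₂ ℕ._+_ (DivMod.m<n⇒m/n≡0 (Finₚ.toℕ<n r)) (DivMod.m*n/n≡m q 6))

class-index : ∀ q r → class (index q r) ≡ r
class-index q r = Finₚ.toℕ-injective (trans (Finₚ.toℕ-fromℕ< (DivMod.m%n<n (index q r) 6))
  (trans (DivMod.[m+kn]%n≡m%n (toℕ r) q 6) (DivMod.m<n⇒m%n≡m (Finₚ.toℕ<n r))))

location : ℕ → Point
location m = 3 ^ layer m · site (class m)

index-cancel : ∀ m m′ → layer m ≡ layer m′ → class m ≡ class m′ → m ≡ m′
index-cancel m m′ layer≡ class≡ =
  trans (sym (index-layer-class m)) (trans (cong₂ index layer≡ class≡) (index-layer-class m′))

location-injective : ∀ m m′ → embed (location m) ≈₂ embed (location m′) → m ≡ m′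
location-injective m m′ eq =
  let (o , offset , ¬clear) = meeting-offset (layer m) (layer m′) (inj₂ (class m)) (inj₂ (class m′))
         midpoint midpoint midpoint-interior midpoint-interior (embed-meets (location m) (location m′) eq)
  in [ (λ (class≡ , o≡2) → index-cancel m m′
         (sym (ℕₚ.+-cancelʳ-≡ 2 _ _ (trans offset (cong (λ o → layer m ℕ.+ toℕ o) o≡2)))) class≡)
     , (λ clear → contradiction clear ¬clear) ]′ (near-sites (class m) (class m′) o)

-- The graph and its drawing

Joins : Bond → ℕ → ℕ → Set
Joins e m m′ = class m ≡ src e × class m′ ≡ tgt e × layer m′ ≡ layer m ℕ.+ rise e

joins? : ∀ e m m′ → Dec (Joins e m m′)
joins? e m m′ = class m Fin.≟ src e ×-dec class m′ Fin.≟ tgt e ×-dec layer m′ ℕ.≟ layer m ℕ.+ rise e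

Linked : ℕ → ℕ → Set
Linked m m′ = ∃[ e ] Joins e m m′

linked? : ∀ m m′ → Dec (Linked m m′)
linked? m m′ = Finₚ.any? λ e → joins? e m m′

-- Yields both the absence of loops and the orientation of each edge from `lo` to `hi`.
linked⇒< : ∀ m m′ → Linked m m′ → m ℕ.< m′
linked⇒< m m′ (e , class≡ , class≡′ , layer≡) =
  subst₂ ℕ._<_ (index-layer-class m) (index-layer-class m′) (begin-strict
    toℕ (class m) ℕ.+ layer m ℕ.* 6                          ≡⟨ cong (λ r → toℕ r ℕ.+ layer m ℕ.* 6) class≡ ⟩
    toℕ (src e) ℕ.+ layer m ℕ.* 6                            <⟨ ℕₚ.+-monoˡ-< (layer m ℕ.* 6) (bond-increasing e) ⟩
    toℕ (tgt e) ℕ.+ rise e ℕ.* 6 ℕ.+ layer m ℕ.* 6           ≡⟨ ℕₚ.+-assoc (toℕ (tgt e)) _ _ ⟩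
    toℕ (tgt e) ℕ.+ (rise e ℕ.* 6 ℕ.+ layer m ℕ.* 6)         ≡⟨ cong (toℕ (tgt e) ℕ.+_) (ℕₚ.+-comm (rise e ℕ.* 6) _) ⟩
    toℕ (tgt e) ℕ.+ (layer m ℕ.* 6 ℕ.+ rise e ℕ.* 6)         ≡⟨ cong (toℕ (tgt e) ℕ.+_) (ℕₚ.*-distribʳ-+ 6 (layer m) (rise e)) ⟨
    toℕ (tgt e) ℕ.+ (layer m ℕ.+ rise e) ℕ.* 6               ≡⟨ cong₂ index layer≡ class≡′ ⟨
    toℕ (class m′) ℕ.+ layer m′ ℕ.* 6                        ∎)
  where open ℕₚ.≤-Reasoning

Adjacent : ℕ → ℕ → Set
Adjacent m m′ = Linked m m′ ⊎ Linked m′ m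

adjacent? : ∀ m m′ → Dec (Adjacent m m′)
adjacent? m m′ = linked? m m′ ⊎-dec linked? m′ m

-- Adjacency depends on the vertex numbers alone, so this is the subgraph induced by the first n
-- vertices of a single infinite graph.
layeredGraph : ∀ n → Graph n
layeredGraph n = record
  { adj    = λ u v → ⌊ adjacent? (toℕ u) (toℕ v) ⌋
  ; sym    = λ u v → trans (isYes≗does (adjacent? (toℕ u) (toℕ v)))
      (trans (∨-comm (Dec.does (linked? (toℕ u) (toℕ v))) (Dec.does (linked? (toℕ v) (toℕ u))))
             (sym (isYes≗does (adjacent? (toℕ v) (toℕ u)))))
  ; irrefl = λ u → trans (isYes≗does (adjacent? (toℕ u) (toℕ u)))
      (dec-false (adjacent? (toℕ u) (toℕ u)) [ unlinked (toℕ u) , unlinked (toℕ u) ]′)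
  }
  where
  unlinked : ∀ m → ¬ Linked m m
  unlinked m l = ℕₚ.<-irrefl refl (linked⇒< m m l)

module _ {n : ℕ} where

  open Edge {n} {layeredGraph n}

  lower-end upper-end : Edge (layeredGraph n) → ℕ
  lower-end E = toℕ (lo E)
  upper-end E = toℕ (hi E)

  edge-linked : ∀ E → Linked (lower-end E) (upper-end E)
  edge-linked E =
    [ (λ l → l) , (λ l → contradiction (linked⇒< (upper-end E) (lower-end E) l) (ℕₚ.<-asym (lo<hi E))) ]′
      (toWitness {a? = adjacent? (lower-end E) (upper-end E)} (adjacent E))

  bond : Edge (layeredGraph n) → Bond
  bond E = proj₁ (edge-linked E)

  edge-≡ : ∀ E E′ → lower-end E ≡ lower-end E′ → upper-end E ≡ upper-end E′ → E ≡ E′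
  edge-≡ E E′ lo≡ hi≡ = go E E′ (Finₚ.toℕ-injective lo≡) (Finₚ.toℕ-injective hi≡)
    where
    go : ∀ E E′ → lo E ≡ lo E′ → hi E ≡ hi E′ → E ≡ E′
    go (mkEdge l h p a) (mkEdge .l .h p′ a′) refl refl =
      cong₂ (mkEdge l h) (ℕₚ.<-irrelevant p p′) (T-irrelevant a a′)

  edge-determined : ∀ E E′ → layer (lower-end E) ≡ layer (lower-end E′) → bond E ≡ bond E′ → E ≡ E′
  edge-determined E E′ layer≡ bond≡ =
    let (_ , class≡ , class≡₂ , rise≡) = edge-linked E
        (_ , class≡′ , class≡₂′ , rise≡′) = edge-linked E′
    in edge-≡ E E′
      (index-cancel _ _ layer≡ (trans class≡ (trans (cong src bond≡) (sym class≡′))))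
      (index-cancel _ _ (trans rise≡ (trans (cong₂ ℕ._+_ layer≡ (cong rise bond≡)) (sym rise≡′)))
                        (trans class≡₂ (trans (cong tgt bond≡) (sym class≡₂′))))

  segment : Edge (layeredGraph n) → Segment
  segment E = location (lower-end E) , location (upper-end E)

  segment-place : ∀ E → segment E ≡ place (layer (lower-end E)) (inj₁ (bond E))
  segment-place E = let (e , class≡ , class≡′ , layer≡) = edge-linked E in
    cong₂ _,_ (cong (λ r → 3 ^ layer (lower-end E) · site r) class≡)
      (trans (cong₂ (λ q r → 3 ^ q · site r) layer≡ class≡′)
        (trans (cong (_· site (tgt e)) (ℕₚ.^-distribˡ-+-* 3 (layer (lower-end E)) (rise e)))
               (sym (·-· (3 ^ layer (lower-end E)) (3 ^ rise e) (site (tgt e))))))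

  segment-nondegenerate : ∀ E → proj₁ (segment E) ≢ proj₂ (segment E)
  segment-nondegenerate E eq = ℕₚ.<⇒≢ (lo<hi E)
    (location-injective (lower-end E) (upper-end E)
      (subst (λ p → embed (location (lower-end E)) ≈₂ embed p) eq (≈₂-refl (embed (location (lower-end E))))))

  segment-avoids : ∀ E t → Interior t → ∀ m → ¬ (along (segment E) t ≈₂ embed (location m))
  segment-avoids E t t° m meet =
    let (o , _ , ¬clear) = meeting-offset (layer (lower-end E)) (layer m) (inj₁ (bond E)) (inj₂ (class m))
          t midpoint t° midpoint-interior
          (subst (λ σ → along σ t ≈₂ along (location m , location m) midpoint) (segment-place E)
            (meets-embed (segment E) t (location m) meet))
    in ¬clear (near-bond-site (bond E) (class m) o)

  drawing : Drawing (layeredGraph n)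
  drawing = record
    { pos           = λ u → embed (location (toℕ u))
    ; pos-injective = λ u v eq → Finₚ.toℕ-injective (location-injective (toℕ u) (toℕ v) eq)
    ; arc           = λ E → straight (segment E) (segment-nondegenerate E)
    ; avoids        = λ E t t° w → segment-avoids E t t° (toℕ w)
    }

  -- Crossings along one edge

  open Crossing

  -- Charges each crossing to an entry of the finite list of potential crossings of its bond.
  crossing-offset : ∀ E (c : Crossing drawing E) →
    ∃[ o ] (layer (lower-end (other c)) ℕ.+ 2 ≡ layer (lower-end E) ℕ.+ toℕ o
            × (bond (other c) , o) ∈ crossings (bond E))
  crossing-offset E c =
    let E′ = other c
        (o , offset , ¬clear) = meeting-offset (layer (lower-end E)) (layer (lower-end E′))
          (inj₁ (bond E)) (inj₁ (bond E′))
          (at c) (otherAt c) (at-int c) (otherAt-int c)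
          (subst₂ (λ σ τ → along σ (at c) ≈₂ along τ (otherAt c)) (segment-place E) (segment-place E′) (meet c))
        -- Offset 2 means equal layers, and layer and bond together determine the edge.
        distinct : ¬ (bond E ≡ bond E′ × o ≡ # 2)
        distinct = λ (bond≡ , o≡2) → other≢e c (edge-determined E′ E
          (ℕₚ.+-cancelʳ-≡ 2 _ _ (trans offset (cong (λ o → layer (lower-end E) ℕ.+ toℕ o) o≡2))) (sym bond≡))
    in o , offset , crosses⇒∈-crossings (bond E) (bond E′ , o) (distinct , ¬clear)

  crossing-transversal : ∀ E (c : Crossing drawing E) → Transversal (segment E) (segment (other c))
  crossing-transversal E c = let (o , _ , x∈) = crossing-offset E c in
    subst₂ Transversal (sym (segment-place E)) (sym (segment-place (other c)))
      (transversal-scale (3 ^ layer (lower-end E)) {{3^≢0 (layer (lower-end E))}}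
        (3 ^ layer (lower-end (other c))) {{3^≢0 (layer (lower-end (other c)))}}
        (shape (inj₁ (bond E))) (shape (inj₁ (bond (other c))))
        (All.lookup (crossings-transversal (bond E)) x∈))

  same-other⇒same-crossing : ∀ E (c c′ : Crossing drawing E) → other c ≡ other c′ → SameCrossing c c′
  same-other⇒same-crossing E c c′ other≡ = other≡ ,
    transversal⇒unique (segment E) (segment (other c)) (crossing-transversal E c)
      (at c) (otherAt c) (at c′) (otherAt c′) (meet c)
      (subst (λ E′ → along (segment E) (at c′) ≈₂ along (segment E′) (otherAt c′)) (sym other≡) (meet c′))

  slot : ∀ E → Crossing drawing E → Fin (length (crossings (bond E)))
  slot E c = Any.index (proj₂ (proj₂ (crossing-offset E c)))

  same-slot⇒same-other : ∀ E (c c′ : Crossing drawing E) → slot E c ≡ slot E c′ → other c ≡ other c′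
  same-slot⇒same-other E c c′ slot≡ =
    let (o , offset , x∈) = crossing-offset E c
        (o′ , offset′ , x∈′) = crossing-offset E c′
        x≡x′ : (bond (other c) , o) ≡ (bond (other c′) , o′)
        x≡x′ = trans (lookup-index x∈) (trans (cong (List.lookup (crossings (bond E))) slot≡) (sym (lookup-index x∈′)))
    in edge-determined (other c) (other c′)
      (ℕₚ.+-cancelʳ-≡ 2 _ _ (trans offset (trans (cong (λ x → layer (lower-end E) ℕ.+ toℕ (proj₂ x)) x≡x′) (sym offset′))))
      (cong proj₁ x≡x′)

  crossed-at-most-3 : ∀ E → CrossedAtMost 3 drawing E
  crossed-at-most-3 E (c , distinct) =
    -- Four crossings share at most three slots. Two in one slot have the same other edge, and
    -- transversality then forces the same point.
    let (i , j , i<j , slot≡) = Finₚ.pigeonhole (ℕ.s≤s (at-most-three (bond E))) (slot E ∘ c)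
    in distinct i j (Finₚ.<⇒≢ i<j)
         (same-other⇒same-crossing E (c i) (c j) (same-slot⇒same-other E (c i) (c j) slot≡))

-- Girth

displacement : ℕ → ℕ → Move
displacement m m′ = class m′ , + layer m′ ℤ.- + layer m

displacement∈moves : ∀ m m′ → Adjacent m m′ → displacement m m′ ∈ moves (class m)
displacement∈moves m m′ (inj₁ (e , class≡ , class≡′ , layer≡)) =
  subst₂ (λ d r → d ∈ moves r) (cong₂ _,_ (sym class≡′) (sym climb)) (sym class≡) (ascent∈moves e)
  where
  climb : + layer m′ ℤ.- + layer m ≡ + rise e
  climb = trans (cong (λ q → + q ℤ.- + layer m) layer≡)
    (trans (cong (ℤ._- + layer m) (ℤₚ.pos-+ (layer m) (rise e)))
           (solve 2 (λ q k → q :+ k :- q := k) refl (+ layer m) (+ rise e)))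
    where open ℤ-Solver
displacement∈moves m m′ (inj₂ (e , class≡ , class≡′ , layer≡)) =
  subst₂ (λ d r → d ∈ moves r) (cong₂ _,_ (sym class≡) (sym fall)) (sym class≡′) (descent∈moves e)
  where
  fall : + layer m′ ℤ.- + layer m ≡ ℤ.- + rise e
  fall = trans (cong (λ q → + layer m′ ℤ.- + q) layer≡)
    (trans (cong (λ z → + layer m′ ℤ.- z) (ℤₚ.pos-+ (layer m′) (rise e)))
           (solve 2 (λ q k → q :- (q :+ k) := :- k) refl (+ layer m′) (+ rise e)))
    where open ℤ-Solver

-- Around a closed walk the layer changes telescope to 0, which is the situation excluded by
-- `no-triangle`.
triangle-free : ∀ m₀ m₁ m₂ → Adjacent m₀ m₁ → Adjacent m₁ m₂ → ¬ Adjacent m₂ m₀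
triangle-free m₀ m₁ m₂ a₁ a₂ a₃ =
  All.lookup (All.lookup (All.lookup (no-triangle (class m₀))
    (displacement∈moves m₀ m₁ a₁)) (displacement∈moves m₁ m₂ a₂)) (displacement∈moves m₂ m₀ a₃)
  (refl , solve 3 (λ x y z → (y :- x) :+ (z :- y) :+ (x :- z) := con 0ℤ) refl (+ layer m₀) (+ layer m₁) (+ layer m₂))
  where open ℤ-Solver

-- Each backtracking alternative of `no-quadrilateral` identifies the class and the layer of two
-- opposite vertices, hence the vertices.
quadrilateral-free : ∀ m₀ m₁ m₂ m₃ → m₀ ≢ m₂ → m₁ ≢ m₃ →
  Adjacent m₀ m₁ → Adjacent m₁ m₂ → Adjacent m₂ m₃ → ¬ Adjacent m₃ m₀
quadrilateral-free m₀ m₁ m₂ m₃ m₀≢m₂ m₁≢m₃ a₁ a₂ a₃ a₄ =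
  [ (λ (class≡ , d≡0) → m₀≢m₂ (coincide m₀ m₁ m₂ class≡ d≡0))
  , (λ (class≡ , d≡0) → m₁≢m₃ (coincide m₁ m₂ m₃ class≡ d≡0)) ]′
  (All.lookup (All.lookup (All.lookup (All.lookup (no-quadrilateral (class m₀))
    (displacement∈moves m₀ m₁ a₁)) (displacement∈moves m₁ m₂ a₂)) (displacement∈moves m₂ m₃ a₃))
    (displacement∈moves m₃ m₀ a₄)
  (refl , solve 4 (λ x y z w → (y :- x) :+ (z :- y) :+ (w :- z) :+ (x :- w) := con 0ℤ) refl
            (+ layer m₀) (+ layer m₁) (+ layer m₂) (+ layer m₃)))
  where
  open ℤ-Solver
  coincide : ∀ l m n → class n ≡ class l →
    (+ layer m ℤ.- + layer l) ℤ.+ (+ layer n ℤ.- + layer m) ≡ 0ℤ → l ≡ n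
  coincide l m n class≡ d≡0 = index-cancel l n
    (sym (ℤₚ.+-injective (ℤₚ.i-j≡0⇒i≡j (+ layer n) (+ layer l) (trans
      (solve 3 (λ x y z → z :- x := (y :- x) :+ (z :- y)) refl (+ layer l) (+ layer m) (+ layer n)) d≡0))))
    (sym class≡)

adjacent : ∀ {n} (u v : Fin n) → Graph._~_ (layeredGraph n) u v → Adjacent (toℕ u) (toℕ v)
adjacent u v = toWitness {a? = adjacent? (toℕ u) (toℕ v)}

cycle-length≥5 : ∀ {n} ℓ → HasCycleOfLength (layeredGraph n) ℓ → 5 ℕ.≤ ℓ
cycle-length≥5 _ (0 , refl , c) = contradiction (Cycle.length≥3 c) λ { (s≤s ()) }
cycle-length≥5 _ (1 , refl , c) = contradiction (Cycle.length≥3 c) λ { (s≤s (s≤s ())) }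
cycle-length≥5 _ (2 , refl , c) = contradiction (adjacent (v (# 2)) (v (# 0)) close)
  (triangle-free (toℕ (v (# 0))) (toℕ (v (# 1))) (toℕ (v (# 2)))
    (adjacent (v (# 0)) (v (# 1)) (step (# 0))) (adjacent (v (# 1)) (v (# 2)) (step (# 1))))
  where open Cycle c renaming (vertex to v)
cycle-length≥5 _ (3 , refl , c) = contradiction (adjacent (v (# 3)) (v (# 0)) close)
  (quadrilateral-free (toℕ (v (# 0))) (toℕ (v (# 1))) (toℕ (v (# 2))) (toℕ (v (# 3)))
    (λ eq → contradiction (distinct {# 0} {# 2} (Finₚ.toℕ-injective eq)) λ ())
    (λ eq → contradiction (distinct {# 1} {# 3} (Finₚ.toℕ-injective eq)) λ ())
    (adjacent (v (# 0)) (v (# 1)) (step (# 0))) (adjacent (v (# 1)) (v (# 2)) (step (# 1)))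
    (adjacent (v (# 2)) (v (# 3)) (step (# 2))))
  where open Cycle c renaming (vertex to v)
cycle-length≥5 _ (suc (suc (suc (suc m))) , refl , c) = s≤s (s≤s (s≤s (s≤s (s≤s z≤n))))

-- Vertices 0 and 5 lie in layer 0, and 6, 13, 19 in layers 1, 2, 3. The largest number, 19, is what
-- makes 20 vertices suffice.
pentagon : Fin 5 → Fin 20
pentagon = Vec.lookup (# 0 ∷ # 13 ∷ # 19 ∷ # 6 ∷ # 5 ∷ [])

abstract
  pentagon-injective : ∀ i j → pentagon i ≡ pentagon j → i ≡ j
  pentagon-injective = from-yes (Finₚ.all? λ i → Finₚ.all? λ j →
    pentagon i Fin.≟ pentagon j →-dec i Fin.≟ j)

  pentagon-step : ∀ (i : Fin 4) → Adjacent (toℕ (pentagon (inject₁ i))) (toℕ (pentagon (suc i)))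
  pentagon-step = from-yes (Finₚ.all? λ (i : Fin 4) →
    adjacent? (toℕ (pentagon (inject₁ i))) (toℕ (pentagon (suc i))))

  pentagon-close : Adjacent (toℕ (pentagon (# 4))) (toℕ (pentagon (# 0)))
  pentagon-close = from-yes (adjacent? (toℕ (pentagon (# 4))) (toℕ (pentagon (# 0))))

has-pentagon : ∀ {n} → 20 ℕ.≤ n → HasCycleOfLength (layeredGraph n) 5
has-pentagon {n} 20≤n = 4 , refl , record
  { length≥3 = s≤s (s≤s (s≤s z≤n))
  ; vertex   = λ i → inject≤ (pentagon i) 20≤n
  ; distinct = λ {i} {j} eq → pentagon-injective i j (Finₚ.inject≤-injective 20≤n 20≤n _ _ eq)
  ; step     = λ i → transport (pentagon (inject₁ i)) (pentagon (suc i)) (pentagon-step i)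
  ; close    = transport (pentagon (# 4)) (pentagon (# 0)) pentagon-close
  }
  where
  transport : ∀ a b → Adjacent (toℕ a) (toℕ b) → Graph._~_ (layeredGraph n) (inject≤ a 20≤n) (inject≤ b 20≤n)
  transport a b adj = fromWitness {a? = adjacent? (toℕ (inject≤ a 20≤n)) (toℕ (inject≤ b 20≤n))}
    (subst₂ Adjacent (sym (Finₚ.toℕ-inject≤ a 20≤n)) (sym (Finₚ.toℕ-inject≤ b 20≤n)) adj)

girth-5 : ∀ {n} → 20 ℕ.≤ n → HasGirth (layeredGraph n) 5
girth-5 20≤n = has-pentagon 20≤n , cycle-length≥5

-- Counting edges

-- Bonds climb at most two layers, so those starting below the last two full layers stay inside.
full-layers : ℕ → ℕ
full-layers n = n / 6 ℕ.∸ 2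

index-linked : ∀ q e → Linked (index q (src e)) (index (q ℕ.+ rise e) (tgt e))
index-linked q e = e , class-index q (src e) , class-index (q ℕ.+ rise e) (tgt e) ,
  trans (layer-index (q ℕ.+ rise e) (tgt e)) (cong (ℕ._+ rise e) (sym (layer-index q (src e))))

index<n : ∀ n q e → q ℕ.< full-layers n → index (q ℕ.+ rise e) (tgt e) ℕ.< n
index<n n q e q<Q = begin-strict
  toℕ (tgt e) ℕ.+ (q ℕ.+ rise e) ℕ.* 6   <⟨ ℕₚ.+-monoˡ-< _ (Finₚ.toℕ<n (tgt e)) ⟩
  suc (q ℕ.+ rise e) ℕ.* 6               ≤⟨ ℕₚ.*-monoˡ-≤ 6 (s≤s (ℕₚ.+-monoʳ-≤ q (bond-rise≤2 e))) ⟩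
  suc (q ℕ.+ 2) ℕ.* 6                    ≤⟨ ℕₚ.*-monoˡ-≤ 6 (ℕₚ.m≤o∸n⇒m+n≤o (suc q) 2≤n/6 q<Q) ⟩
  n / 6 ℕ.* 6                            ≤⟨ DivMod.m/n*n≤m n 6 ⟩
  n                                      ∎
  where
  open ℕₚ.≤-Reasoning
  2≤n/6 : 2 ℕ.≤ n / 6
  -- Since q lies below it, the truncated difference is not 0, so nothing was truncated.
  2≤n/6 = ℕₚ.<⇒≤ (ℕₚ.m∸n≢0⇒n<m (ℕₚ.m<n⇒n≢0 q<Q))

module _ (n : ℕ) where

  -- Repeats the list inside `numEdges`, so that its length is the edge count by definition.
  edge-pairs : List (Fin n × Fin n)
  edge-pairs = filter (λ e → (proj₁ e Fin.<? proj₂ e) ×-dec T? (Graph.adj (layeredGraph n) (proj₁ e) (proj₂ e)))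
                      (cartesianProduct (allFin n) (allFin n))

  module _ (q : Fin (full-layers n)) (e : Bond) where

    lo-index hi-index : ℕ
    lo-index = index (toℕ q) (src e)
    hi-index = index (toℕ q ℕ.+ rise e) (tgt e)

    hi<n : hi-index ℕ.< n
    hi<n = index<n n (toℕ q) e (Finₚ.toℕ<n q)

    lo<hi : lo-index ℕ.< hi-index
    lo<hi = linked⇒< lo-index hi-index (index-linked (toℕ q) e)

    lo<n : lo-index ℕ.< n
    lo<n = ℕₚ.<-trans lo<hi hi<n

    pair : Fin n × Fin n
    pair = fromℕ< lo<n , fromℕ< hi<n

    pair∈edge-pairs : pair ∈ edge-pairs
    pair∈edge-pairs = ∈-filter⁺ _ (∈-cartesianProduct⁺ (∈-allFin (fromℕ< lo<n)) (∈-allFin (fromℕ< hi<n)))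
      ( subst₂ ℕ._<_ (sym (Finₚ.toℕ-fromℕ< lo<n)) (sym (Finₚ.toℕ-fromℕ< hi<n)) lo<hi
      , fromWitness {a? = adjacent? (toℕ (fromℕ< lo<n)) (toℕ (fromℕ< hi<n))}
          (inj₁ (subst₂ Linked (sym (Finₚ.toℕ-fromℕ< lo<n)) (sym (Finₚ.toℕ-fromℕ< hi<n))
                  (index-linked (toℕ q) e))))

  pair-injective : ∀ q e q′ e′ → pair q e ≡ pair q′ e′ → (q , e) ≡ (q′ , e′)
  pair-injective q e q′ e′ eq = cong₂ _,_ (Finₚ.toℕ-injective q≡)
    (bond-unique e e′ (cong₂ _,_ src≡ (cong₂ _,_ tgt≡ rise≡)))
    where
    lo≡ : lo-index q e ≡ lo-index q′ e′
    lo≡ = trans (sym (Finₚ.toℕ-fromℕ< (lo<n q e)))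
      (trans (cong (toℕ ∘ proj₁) eq) (Finₚ.toℕ-fromℕ< (lo<n q′ e′)))
    hi≡ : hi-index q e ≡ hi-index q′ e′
    hi≡ = trans (sym (Finₚ.toℕ-fromℕ< (hi<n q e)))
      (trans (cong (toℕ ∘ proj₂) eq) (Finₚ.toℕ-fromℕ< (hi<n q′ e′)))
    layer-cancel : ∀ {q r q′ r′} → index q r ≡ index q′ r′ → q ≡ q′
    layer-cancel {q} {r} {q′} {r′} eq = trans (sym (layer-index q r)) (trans (cong layer eq) (layer-index q′ r′))
    class-cancel : ∀ {q r q′ r′} → index q r ≡ index q′ r′ → r ≡ r′
    class-cancel {q} {r} {q′} {r′} eq = trans (sym (class-index q r)) (trans (cong class eq) (class-index q′ r′))
    q≡ : toℕ q ≡ toℕ q′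
    q≡ = layer-cancel {toℕ q} {src e} {toℕ q′} {src e′} lo≡
    src≡ : src e ≡ src e′
    src≡ = class-cancel {toℕ q} {src e} {toℕ q′} {src e′} lo≡
    tgt≡ : tgt e ≡ tgt e′
    tgt≡ = class-cancel {toℕ q ℕ.+ rise e} {tgt e} {toℕ q′ ℕ.+ rise e′} {tgt e′} hi≡
    rise≡ : rise e ≡ rise e′
    rise≡ = ℕₚ.+-cancelˡ-≡ (toℕ q) _ _ (trans
      (layer-cancel {toℕ q ℕ.+ rise e} {tgt e} {toℕ q′ ℕ.+ rise e′} {tgt e′} hi≡) (cong (ℕ._+ rise e′) (sym q≡)))

  -- Sending a layer and a bond to the position of their edge in the list is an injection between
  -- finite sets.
  many-edges : full-layers n ℕ.* 15 ℕ.≤ numEdges (layeredGraph n)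
  many-edges = Finₚ.injective⇒≤ {f = position} λ {i} {j} eq →
    trans (sym (Finₚ.combine-remQuot {full-layers n} 15 i))
      (trans (cong (λ (q , e) → combine q e) (unpaired i j eq)) (Finₚ.combine-remQuot {full-layers n} 15 j))
    where
    key : Fin (full-layers n ℕ.* 15) → Fin (full-layers n) × Bond
    key = remQuot 15
    member : ∀ i → pair (proj₁ (key i)) (proj₂ (key i)) ∈ edge-pairs
    member i = pair∈edge-pairs (proj₁ (key i)) (proj₂ (key i))
    position : Fin (full-layers n ℕ.* 15) → Fin (length edge-pairs)
    position i = Any.index (member i)
    unpaired : ∀ i j → position i ≡ position j → key i ≡ key j
    unpaired i j eq = pair-injective _ _ _ _
      (trans (lookup-index (member i)) (trans (cong (List.lookup edge-pairs) eq) (sym (lookup-index (member j)))))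

edge-count : ∀ n → 5 ℕ.* n ℕ.≤ 2 ℕ.* (numEdges (layeredGraph n) ℕ.+ 43)
edge-count n = begin
  5 ℕ.* n                          ≤⟨ ℕₚ.*-monoʳ-≤ 5 n≤ ⟩
  5 ℕ.* (5 ℕ.+ (2 ℕ.+ Q) ℕ.* 6)    ≡⟨ solve 1 (λ q → con 5 :* (con 5 :+ (con 2 :+ q) :* con 6)
                                                       := con 85 :+ con 30 :* q) refl Q ⟩
  -- The loss is 85 = 5 * 17, from at most 5 vertices of an incomplete layer and 12 in the last two
  -- full ones. Rounded up to 86 = 2 * 43, it gives the constant 43.
  85 ℕ.+ 30 ℕ.* Q                  ≤⟨ ℕₚ.+-monoˡ-≤ (30 ℕ.* Q) (ℕₚ.n≤1+n 85) ⟩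
  86 ℕ.+ 30 ℕ.* Q                  ≡⟨ solve 1 (λ q → con 86 :+ con 30 :* q
                                                       := con 2 :* (q :* con 15 :+ con 43)) refl Q ⟩
  2 ℕ.* (Q ℕ.* 15 ℕ.+ 43)          ≤⟨ ℕₚ.*-monoʳ-≤ 2 (ℕₚ.+-monoˡ-≤ 43 (many-edges n)) ⟩
  2 ℕ.* (numEdges (layeredGraph n) ℕ.+ 43) ∎
  where
  open ℕₚ.≤-Reasoning
  open ℕ-Solver
  Q = full-layers n
  n≤ : n ℕ.≤ 5 ℕ.+ (2 ℕ.+ Q) ℕ.* 6
  n≤ = begin
    n                        ≡⟨ DivMod.m≡m%n+[m/n]*n n 6 ⟩
    n % 6 ℕ.+ n / 6 ℕ.* 6    ≤⟨ ℕₚ.+-mono-≤ (ℕₚ.≤-pred (DivMod.m%n<n n 6)) (ℕₚ.*-monoˡ-≤ 6 (ℕₚ.m≤n+m∸n (n / 6) 2)) ⟩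
    5 ℕ.+ (2 ℕ.+ Q) ℕ.* 6    ∎

theorem22 : Σ[ C ∈ ℕ ] Σ[ N ∈ ℕ ] (∀ (n : ℕ) → N ≤ n →
    Σ[ G ∈ Graph n ] (KPlanar 3 G × HasGirth G 5 × 5 * n ≤ 2 * (numEdges G + C)))
theorem22 = 43 , 20 , λ n 20≤n →
  layeredGraph n , (drawing , crossed-at-most-3) , girth-5 20≤n , edge-count n
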